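{- Let $\hat\tau\in\mathbb{N}$ and let $g := \lceil 5\cdot n_{\mathcal L}\cdot \hat\tau\cdot \log \hat\tau\rceil$. Let $0<\varepsilon< 2^{ -(g+1)(g+2)}$. Then there is some $k_\varepsilon\in\mathbb{N}$ such that for every finite $\mathcal{L}$-structure $\mathcal{M}$ with underlying set $M$, if $|M|\ge k_\varepsilon$ and $\mathcal{M}$ has the non-$\hat\tau$-branching property, then there exist an $\mathcal{L}$-structure $\mathcal{N}$ with underlying set $M$ and an equitable partition $P$ of $M$ such that: (1) for every $E\in\mathcal{L}$, writing $\ell:=\mathrm{arity}(E)$, and every tuple $\langle p_i\rangle_{i<\ell}$ of parts of $P$ (repetitions allowed), \[\Bigl|(E^{\mathcal M}\,\triangle\, E^{\mathcal N})\cap \prod_{i<\ell}p_i\Bigr| \le \ell\cdot\varepsilon\cdot\prod_{i<\ell}|p_i|;\] (2) $P$ is indivisible with respect to $\mathcal{N}$; (3) $|P|\le \varepsilon^{ -g-2}$.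
   Context: $\mathcal{L}$ is a fixed finite relational language (equality is a logical symbol, not a member of $\mathcal L$). For $E\in\mathcal L$, $\mathrm{arity}(E)$ is its arity; $q_{\mathcal L}:=\max\{\mathrm{arity}(E):E\in\mathcal L\}$ and $n_{\mathcal L}:=|\mathcal L|\cdot q_{\mathcal L}$. All logarithms are base 2. For an $\mathcal L$-structure $\mathcal M$, $E^{\mathcal M}\subseteq M^{\mathrm{arity}(E)}$ is the interpretation of $E$. Branching property: for $\hat\tau\in\mathbb N$, a formula $\varphi(\bar x;\bar y)$ (with the indicated partition of its variables) has the $\hat\tau$-branching property in $\mathcal M$ if there are tuples $\langle \bar a_i\rangle_{i\in\{0,1\}^{\hat\tau}}$ from $M$ of length $|\bar x|$ and $\langle \bar b_j\rangle_{j\in\{0,1\}^{<\hat\tau}}$ from $M$ of length $|\bar y|$ such that for all $i\in\{0,1\}^{\hat\tau}$, $j\in\{0,1\}^{<\hat\tau}$, $h\in\{0,1\}$: if $j^\frown h$ is an initial segment of $i$, then $\mathcal M\models\varphi(\bar a_i;\bar b_j)$ iff $h=1$. The structure $\mathcal M$ has the non-$\hat\tau$-branching property if for every $E\in\mathcal L$ and every $j<\mathrm{arity}(E)$, the formula $E(x_0,\dots,x_{\mathrm{arity}(E)-1})$ with variable partition $(x_j;\,x_0,\dots,x_{j-1},x_{j+1},\dots,x_{\mathrm{arity}(E)-1})$ does not have the $\hat\tau$-branching property in $\mathcal M$. A partition $P$ of $M$ is equitable if $\bigl||p_0|-|p_1|\bigr|\le 1$ for all parts $p_0,p_1$. It is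 indivisible with respect to an $\mathcal L$-structure $\mathcal N$ on $M$ if for every $E\in\mathcal L$ of arity $k$, all parts $p_0,\dots,p_{k-1}\in P$, and all tuples $\langle a^0_i\rangle_{i<k},\langle a^1_i\rangle_{i<k}$ with $a^0_i,a^1_i\in p_i$, we have $\mathcal N\models E(a^0_0,\dots,a^0_{k-1})\leftrightarrow E(a^1_0,\dots,a^1_{k-1})$.
   Formalization: The number ε, which the statement takes to be real, is restricted to rational values. -}

module Defs where

open import Data.Nat as ℕ using (ℕ; zero; suc; _⊔_)
open import Data.Nat.Logarithm using (⌈log₂_⌉)
open import Data.Fin using (Fin; toℕ)
open import Data.Fin.Properties using () renaming (_≟_ to _≟ᶠ_)
open import Data.Bool using (Bool; true; false)
open import Data.Bool.Properties using () renaming (_≟_ to _≟ᵇ_)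
open import Data.Vec as Vec using (Vec; []; _∷_; lookup; insertAt)
open import Data.Vec.Properties using (≡-dec)
open import Data.List as List using (List; length; filter; concatMap; allFin; foldr; take)
open import Data.Integer using (+_)
open import Data.Nat.ListAction using (product)
open import Data.Rational using (ℚ; _/_; _*_; 1ℚ)
open import Data.Product using (Σ; _×_; _,_; ∃)
open import Relation.Nullary using (¬_; ¬?)
open import Relation.Nullary.Decidable using (_×-dec_)
open import Relation.Binary.PropositionalEquality using (_≡_)
open import Function.Bundles using (_⇔_)

record Lang : Set where
  field
    size  : ℕ
    arity : Fin size → ℕ
open Lang public

qL : Lang → ℕ
qL L = foldr _⊔_ 0 (List.map (arity L) (allFin (size L)))

nL : Lang → ℕ
nL L = size L ℕ.* qL L

-- g = ⌈ 5 · n_L · τ · log₂ τ ⌉ = ⌈ log₂ (τ ^ (5 · n_L · τ)) ⌉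
-- (with the convention 0 · log 0 = 0, which this gives for τ = 0)
gOf : Lang → ℕ → ℕ
gOf L τ = ⌈log₂ (τ ℕ.^ (5 ℕ.* nL L ℕ.* τ)) ⌉

Structure : Lang → ℕ → Set
Structure L N = (E : Fin (size L)) → Vec (Fin N) (arity L E) → Bool

-- φ(x_j ; rest) with x_j inserted at position j of the parameter tuple.
-- The τ-branching property for R at position j: a indexed by {0,1}^τ, b by
-- binary strings (only those of length < τ matter).  The condition
-- "j⌢h initial segment of i" is unfolded as: j = first d bits of i, h = i_d, d < τ.
HasBranchingAt : {N : ℕ} (τ n : ℕ) → (Vec (Fin N) n → Bool) → Fin n → Set
HasBranchingAt {N} τ (suc k) R j =
  Σ (Vec Bool τ → Fin N) λ a →
  Σ (List Bool → Vec (Fin N) k) λ b →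
    (i : Vec Bool τ) (d : Fin τ) →
      (R (insertAt (b (take (toℕ d) (Vec.toList i))) j (a i)) ≡ true) ⇔ (lookup i d ≡ true)

NonBranching : {L : Lang} {N : ℕ} → ℕ → Structure L N → Set
NonBranching {L} τ 𝓜 = (E : Fin (size L)) (j : Fin (arity L E)) →
  ¬ HasBranchingAt τ (arity L E) (𝓜 E) j

allVecs : (N k : ℕ) → List (Vec (Fin N) k)
allVecs N zero = List.[ [] ]
allVecs N (suc k) = concatMap (λ x → List.map (x ∷_) (allVecs N k)) (allFin N)

IsPartition : {N r : ℕ} → (Fin N → Fin r) → Set
IsPartition {N} {r} part = (p : Fin r) → ∃ λ x → part x ≡ p

partSize : {N r : ℕ} → (Fin N → Fin r) → Fin r → ℕ
partSize {N} part p = length (filter (λ x → part x ≟ᶠ p) (allFin N))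

IsEquitable : {N r : ℕ} → (Fin N → Fin r) → Set
IsEquitable {N} {r} part = (p₀ p₁ : Fin r) → partSize part p₀ ℕ.≤ suc (partSize part p₁)

IsIndivisible : {L : Lang} {N r : ℕ} → (Fin N → Fin r) → Structure L N → Set
IsIndivisible {L} {N} part 𝓝 = (E : Fin (size L)) (a₀ a₁ : Vec (Fin N) (arity L E)) →
  ((i : Fin (arity L E)) → part (lookup a₀ i) ≡ part (lookup a₁ i)) →
  𝓝 E a₀ ≡ 𝓝 E a₁

symDiffCount : {L : Lang} {N r : ℕ} → (Fin N → Fin r) → Structure L N → Structure L N →
  (E : Fin (size L)) → Vec (Fin r) (arity L E) → ℕ
symDiffCount {L} {N} part 𝓜 𝓝 E ps =
  length (filter (λ t → ≡-dec _≟ᶠ_ (Vec.map part t) ps ×-dec ¬? (𝓜 E t ≟ᵇ 𝓝 E t))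
                 (allVecs N (arity L E)))

boxSize : {N r k : ℕ} → (Fin N → Fin r) → Vec (Fin r) k → ℕ
boxSize part ps = product (Vec.toList (Vec.map (partSize part) ps))

ℕ→ℚ : ℕ → ℚ
ℕ→ℚ n = + n / 1

_^ℚ_ : ℚ → ℕ → ℚ
q ^ℚ zero = 1ℚ
q ^ℚ suc n = q * (q ^ℚ n)

{-# OPTIONS --safe #-}
-- Call A ⊆ M good if every line (an edge relation with all but one argument fixed) is nearly constant
-- on A.  A set without a large good subset splits along lines again and again; the resulting binary
-- tree, coloured by the pairs (E, j), contains a monochromatic subtree of height τ, which is excluded
-- by non-branching.  A sample of a good set is almost as good, so blocks of one common size can be cut
-- off until little is left, and the rest is spread evenly over the blocks.  Finally, an indicator
-- function on a box whose sides are good has small variance by the Efron–Stein inequality, so each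
-- relation is nearly constant on each tuple of parts; 𝓝 takes the majority value.
--
-- Writing e = ⌊1/ε⌋, all estimates are made in ℕ, using 1/2e ≤ ε ≤ 1/e.
module Submission where

-- Two demands fix the block size. A number of parts bounded independently of N forces blocks of
-- size linear in N; and since a subset of a good set need not be good, a block must be checked
-- against all lines, whose number is polynomial in N. Both are met by size `b * u` with `u`
-- proportional to N: for large N there are at most 2^u lines, and one sample keeps the exceptions
-- to all of them below 2u.
--
-- The constants follow backwards. A finished part has at most 4u exceptions, and `b = 16e` makes
-- this a fraction 1/4e. Sampling starts from sets that are good at 4b, so every split costs a
-- factor 4b, and at most d = n_L(τ - 1) splits precede a good subset, because each uses up one of
-- the τ - 1 levels granted to its colour. This gives at most 8b(4b)^d parts. Since 8b = 128e ≤ e²,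
-- that is at most e^(2(d + 1)), and 2d ≤ g. For d = 0 the bound e ≥ 128 may fail, but then the
-- whole set is good and forms a single part.

module Combinatorics where

  open import Defs
  open import Data.Bool.Base as Bool using (Bool; true; false; not; _∧_; if_then_else_)
  open import Data.Bool.Properties using () renaming (_≟_ to _≟ᵇ_)
  open import Data.Empty using (⊥-elim)
  open import Data.Fin.Base using (Fin; zero; suc; toℕ; fromℕ<)
  open import Data.Fin.Properties using (toℕ-injective; toℕ-fromℕ<; toℕ<n) renaming (_≟_ to _≟ᶠ_)
  open import Data.List.Base using (List; []; _∷_; _++_; map; concatMap; allFin; filter; length; take; foldr)
  open import Data.List.Membership.Propositional using (_∈_)
  open import Data.List.Membership.Propositional.Properties using (∈-allFin; ∈-map⁺; ∈-concatMap⁺)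
  open import Data.List.Properties using (map-tabulate; length-tabulate)
  open import Data.List.Relation.Unary.Any as Any using (here; there)
  open import Data.Nat.Base
  open import Data.Nat.DivMod using (_/_; _%_; m/n*n≤m; m≡m%n+[m/n]*n; m%n<n; /-monoˡ-≤; m*n/n≡m)
  open import Data.Nat.Logarithm using (⌈log₂_⌉; ⌈log₂⌉-mono-≤; ⌈log₂2^n⌉≡n)
  open import Data.Nat.Properties
  open import Data.Nat.Tactic.RingSolver using (solve-∀)
  open import Data.Product.Base using (Σ; ∃; _×_; _,_; proj₁; proj₂)
  open import Data.Product.Properties using () renaming (≡-dec to Σ-≡-dec)
  open import Data.Sum.Base using (_⊎_; inj₁; inj₂; [_,_]′)
  open import Data.Unit.Base using (tt)
  open import Data.Vec.Base as Vec using (Vec; []; _∷_; lookup; insertAt; toList)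
  open import Data.Vec.Properties using (≡-dec; lookup-map)
  open import Function.Base using (_∘_; _$_; case_of_)
  open import Function.Bundles using (mk⇔)
  open import Relation.Binary.Definitions using (DecidableEquality)
  open import Relation.Binary.PropositionalEquality
  open import Relation.Nullary using (Dec; yes; no; does; ¬_; ¬?)
  open import Relation.Nullary.Decidable using (dec-true; dec-false; does-⇔; _×-dec_)
  open import Relation.Unary using (Decidable)

  -- Finite sums and indicator functions.

  𝟙 : Bool → ℕ
  𝟙 true  = 1
  𝟙 false = 0

  ∑ : {A : Set} → List A → (A → ℕ) → ℕ
  ∑ []       f = 0
  ∑ (x ∷ xs) f = f x + ∑ xs f

  private variable
    A B : Set

  ∑-cong : ∀ (xs : List A) {f g} → (∀ x → f x ≡ g x) → ∑ xs f ≡ ∑ xs g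
  ∑-cong []       eq = refl
  ∑-cong (x ∷ xs) eq = cong₂ _+_ (eq x) (∑-cong xs eq)

  ∑-mono : ∀ (xs : List A) {f g} → (∀ x → f x ≤ g x) → ∑ xs f ≤ ∑ xs g
  ∑-mono []       le = z≤n
  ∑-mono (x ∷ xs) le = +-mono-≤ (le x) (∑-mono xs le)

  ∑-∈ : ∀ {xs : List A} {x} f → x ∈ xs → f x ≤ ∑ xs f
  ∑-∈ f (here refl)                  = m≤m+n _ _
  ∑-∈ {xs = y ∷ _} f (there x∈xs) = ≤-trans (∑-∈ f x∈xs) (m≤n+m _ (f y))

  ∑-mono-< : ∀ {xs : List A} {f g} {x} → (∀ y → f y ≤ g y) → x ∈ xs → f x < g x → ∑ xs f < ∑ xs g
  ∑-mono-< {xs = _ ∷ xs} le (here refl) lt = +-mono-<-≤ lt (∑-mono xs le)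
  ∑-mono-< {xs = y ∷ _}  le (there x∈)  lt = +-mono-≤-< (le y) (∑-mono-< le x∈ lt)

  ∑-+ : ∀ (xs : List A) f g → ∑ xs (λ x → f x + g x) ≡ ∑ xs f + ∑ xs g
  ∑-+ []       f g = refl
  ∑-+ (x ∷ xs) f g = trans (cong (f x + g x +_) (∑-+ xs f g)) (shuffle (f x) (g x) (∑ xs f) (∑ xs g))
    where
    shuffle : ∀ a b c d → a + b + (c + d) ≡ a + c + (b + d)
    shuffle = solve-∀

  ∑-*ˡ : ∀ (xs : List A) c f → ∑ xs (λ x → c * f x) ≡ c * ∑ xs f
  ∑-*ˡ []       c f = sym (*-zeroʳ c)
  ∑-*ˡ (x ∷ xs) c f = trans (cong (c * f x +_) (∑-*ˡ xs c f)) (sym (*-distribˡ-+ c (f x) (∑ xs f)))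

  ∑-*ʳ : ∀ (xs : List A) c f → ∑ xs (λ x → f x * c) ≡ ∑ xs f * c
  ∑-*ʳ xs c f = trans (∑-cong xs (λ x → *-comm (f x) c)) (trans (∑-*ˡ xs c f) (*-comm c (∑ xs f)))

  ∑-zero : ∀ (xs : List A) → ∑ xs (λ _ → 0) ≡ 0
  ∑-zero []       = refl
  ∑-zero (x ∷ xs) = ∑-zero xs

  ∑-one : ∀ (xs : List A) → ∑ xs (λ _ → 1) ≡ length xs
  ∑-one []       = refl
  ∑-one (x ∷ xs) = cong suc (∑-one xs)

  ∑-const : ∀ (xs : List A) c → ∑ xs (λ _ → c) ≡ length xs * c
  ∑-const []       c = refl
  ∑-const (x ∷ xs) c = cong (c +_) (∑-const xs c)

  ∈⇒0<length : ∀ {xs : List A} {x} → x ∈ xs → 0 < length xs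
  ∈⇒0<length (here _)  = z<s
  ∈⇒0<length (there _) = z<s

  ∑-swap : ∀ (xs : List A) (ys : List B) (f : A → B → ℕ) →
           ∑ xs (λ x → ∑ ys (f x)) ≡ ∑ ys (λ y → ∑ xs (λ x → f x y))
  ∑-swap []       ys f = sym (∑-zero ys)
  ∑-swap (x ∷ xs) ys f =
    trans (cong (∑ ys (f x) +_) (∑-swap xs ys f)) (sym (∑-+ ys (f x) (λ y → ∑ xs (λ z → f z y))))

  ∑-++ : ∀ (xs ys : List A) f → ∑ (xs ++ ys) f ≡ ∑ xs f + ∑ ys f
  ∑-++ []       ys f = refl
  ∑-++ (x ∷ xs) ys f = trans (cong (f x +_) (∑-++ xs ys f)) (sym (+-assoc (f x) _ _))

  ∑-map : ∀ (h : A → B) xs f → ∑ (map h xs) f ≡ ∑ xs (f ∘ h)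
  ∑-map h []       f = refl
  ∑-map h (x ∷ xs) f = cong (f (h x) +_) (∑-map h xs f)

  ∑-concatMap : ∀ (h : A → List B) xs f → ∑ (concatMap h xs) f ≡ ∑ xs (λ x → ∑ (h x) f)
  ∑-concatMap h []       f = refl
  ∑-concatMap h (x ∷ xs) f = trans (∑-++ (h x) _ f) (cong (∑ (h x) f +_) (∑-concatMap h xs f))

  length-filter≡∑ : ∀ {P : A → Set} (P? : Decidable P) xs →
                    length (filter P? xs) ≡ ∑ xs (λ x → 𝟙 (does (P? x)))
  length-filter≡∑ P? [] = refl
  length-filter≡∑ P? (x ∷ xs) with does (P? x)
  ... | true  = cong suc (length-filter≡∑ P? xs)
  ... | false = length-filter≡∑ P? xs

  ∑-allFin-suc : ∀ {n} (f : Fin (suc n) → ℕ) → ∑ (allFin (suc n)) f ≡ f zero + ∑ (allFin n) (f ∘ suc)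
  ∑-allFin-suc {n} f = cong (f zero +_)
    (trans (cong (λ xs → ∑ xs f) (sym (map-tabulate (λ i → i) suc))) (∑-map suc (allFin n) f))

  ∑-δ : ∀ {n} (x : Fin n) → ∑ (allFin n) (λ y → 𝟙 (does (x ≟ᶠ y))) ≡ 1
  ∑-δ {suc n} zero    = trans (∑-allFin-suc {n} (λ y → 𝟙 (does (zero ≟ᶠ y)))) (cong suc (∑-zero (allFin n)))
  ∑-δ {suc n} (suc x) = trans (∑-allFin-suc {n} (λ y → 𝟙 (does (suc x ≟ᶠ y)))) (∑-δ x)

  length-allFin : ∀ n → length (allFin n) ≡ n
  length-allFin n = length-tabulate {n = n} (λ i → i)

  -- Finite search in place of excluded middle: a failed universal claim hands back its
  -- counterexample, later an element of a set or a line that splits it.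
  search : ∀ {P : A → Set} {Q : Set} → (∀ x → P x ⊎ Q) → (xs : List A) → (∀ {x} → x ∈ xs → P x) ⊎ Q
  search ask []       = inj₁ λ ()
  search ask (x ∷ xs) with ask x | search ask xs
  ... | inj₂ q | _       = inj₂ q
  ... | inj₁ _ | inj₂ q  = inj₂ q
  ... | inj₁ p | inj₁ ps = inj₁ λ { (here refl) → p ; (there x∈) → ps x∈ }

  𝟙-∧ : ∀ a b → 𝟙 (a ∧ b) ≡ 𝟙 a * 𝟙 b
  𝟙-∧ true  b = sym (*-identityˡ (𝟙 b))
  𝟙-∧ false b = refl

  𝟙-not : ∀ a → 𝟙 a + 𝟙 (not a) ≡ 1
  𝟙-not true  = refl
  𝟙-not false = refl

  𝟙≤1 : ∀ a → 𝟙 a ≤ 1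
  𝟙≤1 true  = ≤-refl
  𝟙≤1 false = z≤n

  -- Subsets of Fin N

  Sub : ℕ → Set
  Sub N = Fin N → Bool

  module _ {N : ℕ} where

    infix 4 _⊑_

    _⊑_ : Sub N → Sub N → Set
    S ⊑ T = ∀ {x} → S x ≡ true → T x ≡ true

    ∣_∣ : Sub N → ℕ
    ∣ S ∣ = ∑ (allFin N) (𝟙 ∘ S)

    infixl 7 _∩_
    _∩_ : Sub N → Sub N → Sub N
    (S ∩ T) x = S x ∧ T x

    _∖_ : Sub N → Fin N → Sub N
    (S ∖ x) y = S y ∧ not (does (x ≟ᶠ y))

    ∣∣-cong : ∀ {S T : Sub N} → (∀ x → S x ≡ T x) → ∣ S ∣ ≡ ∣ T ∣
    ∣∣-cong eq = ∑-cong (allFin N) (cong 𝟙 ∘ eq)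

    𝟙-mono : ∀ {a b} → (a ≡ true → b ≡ true) → 𝟙 a ≤ 𝟙 b
    𝟙-mono {false} imp = z≤n
    𝟙-mono {true}  imp = ≤-reflexive (cong 𝟙 (sym (imp refl)))

    ∣∣-mono : ∀ {S T : Sub N} → S ⊑ T → ∣ S ∣ ≤ ∣ T ∣
    ∣∣-mono sub = ∑-mono (allFin N) (λ x → 𝟙-mono (sub {x}))

    ∩-⊑ˡ : ∀ {S T : Sub N} → S ∩ T ⊑ S
    ∩-⊑ˡ {S} {x = x} eq with S x
    ... | true = refl

    ∩-⊑ʳ : ∀ {S T : Sub N} → S ∩ T ⊑ T
    ∩-⊑ʳ {S} {x = x} eq with S x
    ... | true = eq

    ∩-intro : ∀ {S T : Sub N} {x} → S x ≡ true → T x ≡ true → (S ∩ T) x ≡ true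
    ∩-intro {S} {T} eq eq′ = cong₂ _∧_ eq eq′

    ∩-monoˡ : ∀ {S S′ T : Sub N} → S ⊑ S′ → S ∩ T ⊑ S′ ∩ T
    ∩-monoˡ {S} {S′} {T} sub eq = ∩-intro {S′} {T} (sub (∩-⊑ˡ {S} {T} eq)) (∩-⊑ʳ {S} {T} eq)

    full : Sub N
    full _ = true

    ∣full∣ : ∣ full ∣ ≡ N
    ∣full∣ = trans (∑-one (allFin N)) (length-allFin N)

    ∣∣≤N : ∀ (S : Sub N) → ∣ S ∣ ≤ N
    ∣∣≤N S = ≤-trans (∣∣-mono {S} {full} (λ _ → refl)) (≤-reflexive ∣full∣)

    ∣∣-split : ∀ (S T : Sub N) → ∣ S ∣ ≡ ∣ S ∩ T ∣ + ∣ S ∩ (not ∘ T) ∣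
    ∣∣-split S T = trans (∑-cong (allFin N) (λ x → pw (S x) (T x))) (∑-+ (allFin N) _ _)
      where
      pw : ∀ a b → 𝟙 a ≡ 𝟙 (a ∧ b) + 𝟙 (a ∧ not b)
      pw true  true  = refl
      pw true  false = refl
      pw false b     = refl

    -- In every use `t` is 0 or 1 and records whether `x` enters the set, so the same lemma covers a
    -- set that gains `x` and its traces on tests that may miss `x`.
    ∣∣-point : ∀ {S T : Sub N} x t → (∀ y → 𝟙 (T y) ≡ 𝟙 (S y) + 𝟙 (does (x ≟ᶠ y)) * t) → ∣ T ∣ ≡ ∣ S ∣ + t
    ∣∣-point {S} {T} x t eq =
      trans (∑-cong (allFin N) eq) (trans (∑-+ (allFin N) _ _)
        (cong (∣ S ∣ +_) (trans (∑-*ʳ (allFin N) t _) (trans (cong (_* t) (∑-δ x)) (*-identityˡ t)))))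

    ∣∖∣ : ∀ {S : Sub N} {x} → S x ≡ true → ∣ S ∣ ≡ suc ∣ S ∖ x ∣
    ∣∖∣ {S} {x} Sx = trans (∣∣-point {S ∖ x} {S} x 1 pw) (+-comm _ 1)
      where
      pw : ∀ y → 𝟙 (S y) ≡ 𝟙 (S y ∧ not (does (x ≟ᶠ y))) + 𝟙 (does (x ≟ᶠ y)) * 1
      pw y with x ≟ᶠ y
      ... | yes refl rewrite Sx = refl
      ... | no  _ with S y
      ...   | true  = refl
      ...   | false = refl

    find : ∀ (S : Sub N) → (∃ λ x → S x ≡ true) ⊎ ∣ S ∣ ≡ 0
    find S with search {P = λ x → S x ≡ false} ask (allFin N)
      where
      ask : ∀ x → S x ≡ false ⊎ ∃ λ y → S y ≡ true
      ask x with S x in eq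
      ... | true  = inj₂ (x , eq)
      ... | false = inj₁ refl
    ... | inj₂ w = inj₁ w
    ... | inj₁ empty = inj₂ (trans (∑-cong (allFin N) (λ x → cong 𝟙 (empty (∈-allFin x)))) (∑-zero (allFin N)))

    nonempty : ∀ {S : Sub N} → 0 < ∣ S ∣ → ∃ λ x → S x ≡ true
    nonempty {S} pos with find S
    ... | inj₁ w  = w
    ... | inj₂ eq = ⊥-elim (n≮0 (subst (0 <_) eq pos))

    ∈⇒0<∣∣ : ∀ {S : Sub N} {x} → S x ≡ true → 0 < ∣ S ∣
    ∈⇒0<∣∣ {S} {x} eq = ≤-trans (≤-reflexive (sym (cong 𝟙 eq))) (∑-∈ (𝟙 ∘ S) (∈-allFin x))

    average : ∀ {S : Sub N} {W} (f : Fin N → ℕ) → 0 < ∣ S ∣ → ∑ (allFin N) (λ x → 𝟙 (S x) * f x) ≤ ∣ S ∣ * W →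
              ∃ λ x → S x ≡ true × f x ≤ W
    average {S} {W} f pos le with search {P = λ x → 𝟙 (S x) * suc W ≤ 𝟙 (S x) * f x} ask (allFin N)
      where
      ask : ∀ x → 𝟙 (S x) * suc W ≤ 𝟙 (S x) * f x ⊎ ∃ λ x → S x ≡ true × f x ≤ W
      ask x with S x in eq
      ... | false = inj₁ z≤n
      ... | true with f x ≤? W
      ...   | yes fx≤W = inj₂ (x , eq , fx≤W)
      ...   | no  fx≰W = inj₁ (*-monoʳ-≤ 1 (≰⇒> {f x} {W} fx≰W))
    ... | inj₂ w = w
    ... | inj₁ big = ⊥-elim (<⇒≱ (*-monoʳ-< ∣ S ∣ {{>-nonZero pos}} (n<1+n W))
            (≤-trans (≤-reflexive (sym (∑-*ʳ (allFin N) (suc W) _)))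
              (≤-trans (∑-mono (allFin N) (λ x → big (∈-allFin x))) le)))

  -- Boxes

  ∈-allVecs : ∀ {N k} (t : Vec (Fin N) k) → t ∈ allVecs N k
  ∈-allVecs []      = here refl
  ∈-allVecs (x ∷ t) = ∈-concatMap⁺ _ (Any.map (λ { refl → ∈-map⁺ (_ ∷_) (∈-allVecs t) }) (∈-allFin x))

  length-allVecs : ∀ N k → length (allVecs N k) ≡ N ^ k
  length-allVecs N zero    = refl
  length-allVecs N (suc k) = begin
    length (allVecs N (suc k))                                         ≡⟨ ∑-one (allVecs N (suc k)) ⟨
    ∑ (allVecs N (suc k)) (λ _ → 1)                                    ≡⟨ ∑-concatMap _ (allFin N) _ ⟩
    ∑ (allFin N) (λ x → ∑ (map (x ∷_) (allVecs N k)) (λ _ → 1))         ≡⟨ ∑-cong (allFin N) inner ⟩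
    ∑ (allFin N) (λ _ → N ^ k * 1)                                     ≡⟨ ∑-*ˡ (allFin N) (N ^ k) _ ⟩
    N ^ k * ∑ (allFin N) (λ _ → 1)                                     ≡⟨ cong (N ^ k *_) ∣full∣ ⟩
    N ^ k * N                                                          ≡⟨ *-comm (N ^ k) N ⟩
    N ^ suc k                                                          ∎
    where
    open ≡-Reasoning
    inner : ∀ x → ∑ (map (x ∷_) (allVecs N k)) (λ _ → 1) ≡ N ^ k * 1
    inner x = trans (∑-map (x ∷_) (allVecs N k) _)
      (trans (∑-one (allVecs N k)) (trans (length-allVecs N k) (sym (*-identityʳ (N ^ k)))))

  -- With `pred n` no proof of positive arity is carried around; `Fin 0` is empty, so `n = 0` needs
  -- no clause.
  line : ∀ {X : Set} {n} → (Vec X n → Bool) → Fin n → Vec X (pred n) → X → Bool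
  line {n = suc _} f j b x = f (insertAt b j x)

  ∑-product : ∀ {A B : Set} (xs : List A) (ys : List B) (p a : A → ℕ) (q b : B → ℕ) →
              ∑ xs (λ x → p x * ∑ ys (λ y → q y * (a x * b y))) ≡
              ∑ xs (λ x → p x * a x) * ∑ ys (λ y → q y * b y)
  ∑-product xs ys p a q b = trans (∑-cong xs outer) (∑-*ʳ xs _ _)
    where
    inner : ∀ x y → q y * (a x * b y) ≡ a x * (q y * b y)
    inner x y = shuffle (q y) (a x) (b y)
      where
      shuffle : ∀ c d e → c * (d * e) ≡ d * (c * e)
      shuffle = solve-∀
    outer : ∀ x → p x * ∑ ys (λ y → q y * (a x * b y)) ≡ p x * a x * ∑ ys (λ y → q y * b y)
    outer x = trans (cong (p x *_) (trans (∑-cong ys (inner x)) (∑-*ˡ ys (a x) _)))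
                    (sym (*-assoc (p x) (a x) _))

  module _ {N : ℕ} where

    -- The indicator of the box. Sums over a box become weighted sums over all tuples, which can be
    -- exchanged freely with other sums.
    weight : ∀ {k} → Vec (Sub N) k → Vec (Fin N) k → ℕ
    weight []       []      = 1
    weight (S ∷ Ss) (x ∷ t) = 𝟙 (S x) * weight Ss t

    box : ∀ {k} → Vec (Sub N) k → (Vec (Fin N) k → ℕ) → ℕ
    box {k} Ss f = ∑ (allVecs N k) (λ t → weight Ss t * f t)

    volume : ∀ {k} → Vec (Sub N) k → ℕ
    volume Ss = box Ss (λ _ → 1)

    box-∷ : ∀ {k} S (Ss : Vec (Sub N) k) f →
            box (S ∷ Ss) f ≡ ∑ (allFin N) (λ x → 𝟙 (S x) * box Ss (f ∘ (x ∷_)))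
    box-∷ {k} S Ss f = trans (∑-concatMap _ (allFin N) _) (∑-cong (allFin N) λ x →
      trans (∑-map (x ∷_) (allVecs N k) _)
        (trans (∑-cong (allVecs N k) (λ t → *-assoc (𝟙 (S x)) (weight Ss t) (f (x ∷ t))))
          (∑-*ˡ (allVecs N k) (𝟙 (S x)) _)))

    box-cong : ∀ {k} (Ss : Vec (Sub N) k) {f g} → (∀ t → f t ≡ g t) → box Ss f ≡ box Ss g
    box-cong {k} Ss eq = ∑-cong (allVecs N k) (λ t → cong (weight Ss t *_) (eq t))

    box-mono : ∀ {k} (Ss : Vec (Sub N) k) {f g} → (∀ t → f t ≤ g t) → box Ss f ≤ box Ss g
    box-mono {k} Ss le = ∑-mono (allVecs N k) (λ t → *-monoʳ-≤ (weight Ss t) (le t))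

    box-+ : ∀ {k} (Ss : Vec (Sub N) k) f g → box Ss (λ t → f t + g t) ≡ box Ss f + box Ss g
    box-+ {k} Ss f g = trans (∑-cong (allVecs N k) (λ t → *-distribˡ-+ (weight Ss t) (f t) (g t)))
                         (∑-+ (allVecs N k) _ _)

    box-∑ : ∀ {k} (Ss : Vec (Sub N) k) {A : Set} (xs : List A) (c : A → ℕ) (g : A → Vec (Fin N) k → ℕ) →
            ∑ xs (λ x → c x * box Ss (g x)) ≡ box Ss (λ t → ∑ xs (λ x → c x * g x t))
    box-∑ {k} Ss xs c g = begin
      ∑ xs (λ x → c x * box Ss (g x))
        ≡⟨ ∑-cong xs (λ x → sym (∑-*ˡ (allVecs N k) (c x) _)) ⟩
      ∑ xs (λ x → ∑ (allVecs N k) (λ t → c x * (weight Ss t * g x t)))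
        ≡⟨ ∑-swap xs (allVecs N k) _ ⟩
      ∑ (allVecs N k) (λ t → ∑ xs (λ x → c x * (weight Ss t * g x t)))
        ≡⟨ ∑-cong (allVecs N k) (λ t → trans (∑-cong xs (λ x → shuffle (c x) (weight Ss t) (g x t)))
                                             (∑-*ˡ xs (weight Ss t) _)) ⟩
      box Ss (λ t → ∑ xs (λ x → c x * g x t)) ∎
      where
      open ≡-Reasoning
      shuffle : ∀ a b d → a * (b * d) ≡ b * (a * d)
      shuffle = solve-∀

    box-*ˡ : ∀ {k} (Ss : Vec (Sub N) k) c f → c * box Ss f ≡ box Ss (λ t → c * f t)
    box-*ˡ Ss c f = begin
      c * box Ss f                                ≡⟨ +-identityʳ _ ⟨
      c * box Ss f + 0                            ≡⟨ box-∑ Ss (c ∷ []) (λ x → x) (λ _ → f) ⟩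
      box Ss (λ t → c * f t + 0)                  ≡⟨ box-cong Ss (λ t → +-identityʳ _) ⟩
      box Ss (λ t → c * f t)                      ∎
      where open ≡-Reasoning

    volume-∷ : ∀ {k} S (Ss : Vec (Sub N) k) → volume (S ∷ Ss) ≡ ∣ S ∣ * volume Ss
    volume-∷ S Ss = trans (box-∷ S Ss _) (∑-*ʳ (allFin N) (volume Ss) (𝟙 ∘ S))

    box-complement : ∀ {k} (Ss : Vec (Sub N) k) f → box Ss (𝟙 ∘ f) + box Ss (𝟙 ∘ not ∘ f) ≡ volume Ss
    box-complement Ss f = trans (sym (box-+ Ss _ _)) (box-cong Ss (λ t → 𝟙-not (f t)))

    -- The Efron–Stein inequality for an indicator function f: the box measure of
    -- {f = 1} × {f = 0} is bounded by resampling the coordinates one at a time.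
    box-variance : ∀ {k} (Ss : Vec (Sub N) k) (f : Vec (Fin N) k → Bool) D →
      (∀ j b → D * (∣ lookup Ss j ∩ line f j b ∣ * ∣ lookup Ss j ∩ (not ∘ line f j b) ∣)
                 ≤ ∣ lookup Ss j ∣ * ∣ lookup Ss j ∣) →
      D * (box Ss (𝟙 ∘ f) * box Ss (𝟙 ∘ not ∘ f)) ≤ k * (volume Ss * volume Ss)
    box-variance [] f D hyp with f []
    ... | true  = ≤-reflexive (*-zeroʳ D)
    ... | false = ≤-reflexive (*-zeroʳ D)
    box-variance {suc k} (S ∷ Ss) f D hyp = begin
      D * (box (S ∷ Ss) (𝟙 ∘ f) * box (S ∷ Ss) (𝟙 ∘ not ∘ f))
        ≡⟨ cong (D *_) (cong₂ _*_ (box-∷ S Ss _) (box-∷ S Ss _)) ⟩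
      D * (∑ xs (λ x → s x * F x) * ∑ xs (λ y → s y * G y))
        ≡⟨ cong (D *_) (∑-product xs xs s F s G) ⟨
      D * ∑ xs (λ x → s x * ∑ xs (λ y → s y * (F x * G y)))
        ≤⟨ *-monoʳ-≤ D (∑-mono xs λ x → *-monoʳ-≤ (s x) (∑-mono xs λ y → *-monoʳ-≤ (s y) (FG x y))) ⟩
      D * ∑ xs (λ x → s x * ∑ xs (λ y → s y * (V * H x y + F y * G y)))
        ≡⟨ cong (D *_) (trans (∑-cong xs split) (∑-+ xs _ _)) ⟩
      D * (∑ xs (λ x → V * (s x * ∑ xs (λ y → s y * H x y))) + ∑ xs (λ x → s x * R))
        ≡⟨ cong (D *_) (cong₂ _+_ (trans (∑-*ˡ xs V _) (cong (V *_) HH)) (∑-*ʳ xs R s)) ⟩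
      D * (V * box Ss (λ t → first t) + ∣ S ∣ * R)
        ≡⟨ shuffle D V (box Ss first) ∣ S ∣ R ⟩
      V * (D * box Ss first) + ∣ S ∣ * (D * R)
        ≤⟨ +-mono-≤ (*-monoʳ-≤ V first≤) (*-monoʳ-≤ ∣ S ∣ R≤) ⟩
      V * (∣ S ∣ * ∣ S ∣ * V) + ∣ S ∣ * (∣ S ∣ * (k * (V * V)))
        ≡⟨ collect k V ∣ S ∣ ⟩
      suc k * (∣ S ∣ * V * (∣ S ∣ * V))
        ≡⟨ cong (suc k *_) (cong₂ _*_ (volume-∷ S Ss) (volume-∷ S Ss)) ⟨
      suc k * (volume (S ∷ Ss) * volume (S ∷ Ss)) ∎
      where
      open ≤-Reasoning
      xs = allFin N
      s = 𝟙 ∘ S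
      V = volume Ss
      F G : Fin N → ℕ
      F x = box Ss (λ t → 𝟙 (f (x ∷ t)))
      G x = box Ss (λ t → 𝟙 (not (f (x ∷ t))))
      h : Fin N → Fin N → Vec (Fin N) k → ℕ
      h x y t = 𝟙 (f (x ∷ t)) * 𝟙 (not (f (y ∷ t)))
      H : Fin N → Fin N → ℕ
      H x y = box Ss (h x y)
      R = ∑ xs (λ y → s y * (F y * G y))
      first : Vec (Fin N) k → ℕ
      first t = ∣ S ∩ line f zero t ∣ * ∣ S ∩ (not ∘ line f zero t) ∣

      shuffle : ∀ D V B S R → D * (V * B + S * R) ≡ V * (D * B) + S * (D * R)
      shuffle = solve-∀
      collect : ∀ k V S → V * (S * S * V) + S * (S * (k * (V * V))) ≡ suc k * (S * V * (S * V))
      collect = solve-∀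

      pointwise : ∀ a b → 𝟙 a ≤ 𝟙 a * 𝟙 (not b) + 𝟙 b
      pointwise false b     = z≤n
      pointwise true  true  = ≤-refl
      pointwise true  false = ≤-refl

      F≤ : ∀ x y → F x ≤ H x y + F y
      F≤ x y = ≤-trans (box-mono Ss (λ t → pointwise (f (x ∷ t)) (f (y ∷ t)))) (≤-reflexive (box-+ Ss _ _))

      G≤V : ∀ y → G y ≤ V
      G≤V y = box-mono Ss (λ t → 𝟙≤1 (not (f (y ∷ t))))

      -- Take `t` with `f (x ∷ t)` true and `t′` with `f (y ∷ t′)` false. If `f (y ∷ t)` is false,
      -- changing the first coordinate alone changes `f`; `H x y` counts such `t`, and `t′` has at
      -- most `V` choices. Otherwise both tuples can be taken over `y`, where induction applies.
      FG : ∀ x y → F x * G y ≤ V * H x y + F y * G y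
      FG x y = begin
        F x * G y                     ≤⟨ *-monoˡ-≤ (G y) (F≤ x y) ⟩
        (H x y + F y) * G y           ≡⟨ *-distribʳ-+ (G y) (H x y) (F y) ⟩
        H x y * G y + F y * G y       ≤⟨ +-monoˡ-≤ (F y * G y) (*-monoʳ-≤ (H x y) (G≤V y)) ⟩
        H x y * V + F y * G y         ≡⟨ cong (_+ F y * G y) (*-comm (H x y) V) ⟩
        V * H x y + F y * G y         ∎

      split : ∀ x → s x * ∑ xs (λ y → s y * (V * H x y + F y * G y)) ≡
                    V * (s x * ∑ xs (λ y → s y * H x y)) + s x * R
      split x = trans (cong (s x *_) (trans (∑-cong xs (λ y → inner (s y) V (H x y) (F y * G y)))
                        (trans (∑-+ xs _ _) (cong (_+ R) (∑-*ˡ xs V _)))))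
                      (outer (s x) V (∑ xs (λ y → s y * H x y)) R)
        where
        inner : ∀ a b c d → a * (b * c + d) ≡ b * (a * c) + a * d
        inner = solve-∀
        outer : ∀ a b c d → a * (b * c + d) ≡ b * (a * c) + a * d
        outer = solve-∀

      -- For fixed `t` the sum over `x` and `y` factors into the two sides of a single line in
      -- direction `zero`, the quantity that `hyp` bounds.
      HH : ∑ xs (λ x → s x * ∑ xs (λ y → s y * H x y)) ≡ box Ss first
      HH = trans (∑-cong xs (λ x → cong (s x *_) (box-∑ Ss xs s (h x))))
          (trans (box-∑ Ss xs s (λ x t → ∑ xs (λ y → s y * h x y t)))
          (box-cong Ss λ t → trans (∑-product xs xs s _ s _)
            (cong₂ _*_ (∑-cong xs (λ x → sym (𝟙-∧ (S x) _))) (∑-cong xs (λ x → sym (𝟙-∧ (S x) _))))))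

      first≤ : D * box Ss first ≤ ∣ S ∣ * ∣ S ∣ * V
      first≤ = begin
        D * box Ss first                       ≡⟨ box-*ˡ Ss D first ⟩
        box Ss (λ t → D * first t)             ≤⟨ box-mono Ss (hyp zero) ⟩
        box Ss (λ t → ∣ S ∣ * ∣ S ∣)           ≡⟨ box-cong Ss (λ _ → sym (*-identityʳ _)) ⟩
        box Ss (λ t → ∣ S ∣ * ∣ S ∣ * 1)       ≡⟨ box-*ˡ Ss (∣ S ∣ * ∣ S ∣) _ ⟨
        ∣ S ∣ * ∣ S ∣ * V                      ∎

      -- A line of the fibre over `y` in direction `j` is a line of `f` in direction `suc j`. The
      -- dimension is generalised because `line` reduces only at a successor.
      hyp-suc : ∀ {k} (Ss : Vec (Sub N) k) (f : Vec (Fin N) (suc k) → Bool) →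
        (∀ j b → D * (∣ lookup (S ∷ Ss) j ∩ line f j b ∣ * ∣ lookup (S ∷ Ss) j ∩ (not ∘ line f j b) ∣)
                 ≤ ∣ lookup (S ∷ Ss) j ∣ * ∣ lookup (S ∷ Ss) j ∣) → ∀ y j b →
        D * (∣ lookup Ss j ∩ line (f ∘ (y ∷_)) j b ∣ * ∣ lookup Ss j ∩ (not ∘ line (f ∘ (y ∷_)) j b) ∣)
                 ≤ ∣ lookup Ss j ∣ * ∣ lookup Ss j ∣
      hyp-suc {suc _} Ss f hyp y j b = hyp (suc j) (y ∷ b)

      R≤ : D * R ≤ ∣ S ∣ * (k * (V * V))
      R≤ = begin
        D * R                                       ≡⟨ ∑-*ˡ xs D _ ⟨
        ∑ xs (λ y → D * (s y * (F y * G y)))        ≡⟨ ∑-cong xs (λ y → comm (s y) (F y * G y)) ⟩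
        ∑ xs (λ y → s y * (D * (F y * G y)))        ≤⟨ ∑-mono xs (λ y → *-monoʳ-≤ (s y)
                                                       (box-variance Ss (f ∘ (y ∷_)) D (hyp-suc Ss f hyp y))) ⟩
        ∑ xs (λ y → s y * (k * (V * V)))            ≡⟨ ∑-*ʳ xs _ s ⟩
        ∣ S ∣ * (k * (V * V))                       ∎
        where
        comm : ∀ a b → D * (a * b) ≡ a * (D * b)
        comm a b = trans (sym (*-assoc D a b)) (trans (cong (_* b) (*-comm D a)) (*-assoc a D b))

    -- The larger count `P` is at least half the volume, so the variance bound on `P * Q` turns into
    -- one on `Q` at the cost of a factor 2. `P` and `Q` stay abstract because either truth value
    -- may be the majority.
    box-minority : ∀ {k} (Ss : Vec (Sub N) k) (f : Vec (Fin N) k → Bool) e →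
      (∀ j b → 4 * e * (∣ lookup Ss j ∩ line f j b ∣ * ∣ lookup Ss j ∩ (not ∘ line f j b) ∣)
                 ≤ ∣ lookup Ss j ∣ * ∣ lookup Ss j ∣) →
      ∀ {P Q} → P * Q ≡ box Ss (𝟙 ∘ f) * box Ss (𝟙 ∘ not ∘ f) → P + Q ≡ volume Ss → Q ≤ P →
      2 * e * Q ≤ k * volume Ss
    box-minority {k} Ss f e hyp {P} {Q} PQ P+Q Q≤P = go (volume Ss) refl
      where
      open ≤-Reasoning
      go : ∀ V → volume Ss ≡ V → 2 * e * Q ≤ k * volume Ss
      go zero eq = ≤-trans (≤-reflexive (trans (cong (2 * e *_) Q≡0) (*-zeroʳ (2 * e)))) z≤n
        where
        Q≡0 : Q ≡ 0
        Q≡0 = n≤0⇒n≡0 (≤-trans (m≤n+m Q P) (≤-reflexive (trans P+Q eq)))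
      go V@(suc _) eq = *-cancelʳ-≤ (2 * e * Q) (k * volume Ss) V $ begin
        2 * e * Q * V                            ≤⟨ *-monoʳ-≤ (2 * e * Q) V≤2P ⟩
        2 * e * Q * (2 * P)                      ≡⟨ shuffle e P Q ⟩
        4 * e * (P * Q)                          ≡⟨ cong (4 * e *_) PQ ⟩
        4 * e * (box Ss (𝟙 ∘ f) * box Ss (𝟙 ∘ not ∘ f))  ≤⟨ box-variance Ss f (4 * e) hyp ⟩
        k * (volume Ss * volume Ss)              ≡⟨ *-assoc k _ _ ⟨
        k * volume Ss * volume Ss                ≡⟨ cong (k * volume Ss *_) eq ⟩
        k * volume Ss * V                        ∎
        where
        shuffle : ∀ e P Q → 2 * e * Q * (2 * P) ≡ 4 * e * (P * Q)
        shuffle = solve-∀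
        V≤2P : V ≤ 2 * P
        V≤2P = begin
          V          ≡⟨ trans P+Q eq ⟨
          P + Q      ≤⟨ +-monoʳ-≤ P Q≤P ⟩
          P + P      ≡⟨ cong (P +_) (+-identityʳ P) ⟨
          2 * P      ∎

  -- Good subsets

  module _ {N : ℕ} where

    side : Bool → Sub N → Sub N
    side true  S = S
    side false S = not ∘ S

    side-true : ∀ σ (S : Sub N) {x} → side σ S x ≡ true → S x ≡ σ
    side-true true  S eq = eq
    side-true false S {x} eq with S x
    ... | false = refl

  -- Independent of the language: a colour will be a relation with a position, `P c` its parameter
  -- tuples, and `φ c b` the resulting line.
  module Tests {N : ℕ} {C : Set} (_≟C_ : DecidableEquality C)
               (cs : List C) (∈cs : ∀ c → c ∈ cs)
               {P : C → Set} (ps : ∀ c → List (P c)) (∈ps : ∀ c (b : P c) → b ∈ ps c)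
               (φ : ∀ c → P c → Sub N) where

    -- `σ` marks the exceptional side; a block sampled from `S` will keep the side chosen here.
    Good : ℕ → Sub N → Set
    Good a S = ∀ c b → ∃ λ σ → a * ∣ S ∩ side σ (φ c b) ∣ ≤ ∣ S ∣

    Split : ℕ → Sub N → Set
    Split a S = ∃ λ c → Σ (P c) λ b → ∀ σ → ∣ S ∣ < a * ∣ S ∩ side σ (φ c b) ∣

    good? : ∀ a S → Good a S ⊎ Split a S
    good? a S with search perColour cs
      where
      perTest : ∀ c b → (∃ λ σ → a * ∣ S ∩ side σ (φ c b) ∣ ≤ ∣ S ∣) ⊎ Split a S
      perTest c b with a * ∣ S ∩ side true (φ c b) ∣ ≤? ∣ S ∣ | a * ∣ S ∩ side false (φ c b) ∣ ≤? ∣ S ∣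
      ... | yes p | _     = inj₁ (true , p)
      ... | no  _ | yes p = inj₁ (false , p)
      ... | no  p | no  q = inj₂ (c , b , λ { true → ≰⇒> p ; false → ≰⇒> q })
      perColour : ∀ c → (∀ {b} → b ∈ ps c → ∃ λ σ → a * ∣ S ∩ side σ (φ c b) ∣ ≤ ∣ S ∣) ⊎ Split a S
      perColour c = search (perTest c) (ps c)
    ... | inj₁ good  = inj₁ λ c b → good (∈cs c) (∈ps c b)
    ... | inj₂ split = inj₂ split

    -- The monochromatic tree. Sides are intersected along a path, so the point at a leaf answers
    -- each test above it as the path prescribes; these points become the tuples indexed by {0,1}^h
    -- in the branching property.
    data Shatter (c : C) : ℕ → Sub N → Set where
      leaf : ∀ {S} x → S x ≡ true → Shatter c 0 S
      node : ∀ {S h} b → (∀ σ → Shatter c h (S ∩ side σ (φ c b))) → Shatter c (suc h) S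

    Shatter-mono : ∀ {c h} {S T : Sub N} → S ⊑ T → Shatter c h S → Shatter c h T
    Shatter-mono S⊑T (leaf x x∈S)  = leaf x (S⊑T x∈S)
    Shatter-mono {c} {S = S} {T} S⊑T (node b t) =
      node b (λ σ → Shatter-mono (∩-monoˡ {S = S} {S′ = T} {T = side σ (φ c b)} S⊑T) (t σ))

    Shatter⇒branching : ∀ {c h S} → (Fin N → P c) → Shatter c h S →
      Σ (Vec Bool h → Fin N) λ a → Σ (List Bool → P c) λ b →
        (∀ i → S (a i) ≡ true) ×
        (∀ i (d : Fin h) → φ c (b (take (toℕ d) (toList i))) (a i) ≡ lookup i d)
    -- No test is asked at or below a leaf; `any x` is only a default that makes `b` total on
    -- strings.
    Shatter⇒branching any (leaf x x∈S) = (λ _ → x) , (λ _ → any x) , (λ _ → x∈S) , λ _ ()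
    Shatter⇒branching {c} {suc h} {S} any (node b t) = a′ , b′ , inside , agrees
      where
      a : Bool → Vec Bool h → Fin N
      a σ = proj₁ (Shatter⇒branching any (t σ))
      spec : ∀ σ → _
      spec σ = proj₂ (Shatter⇒branching any (t σ))
      a′ : Vec Bool (suc h) → Fin N
      a′ (σ ∷ i) = a σ i
      b′ : List Bool → P c
      b′ []      = b
      b′ (σ ∷ w) = proj₁ (spec σ) w
      inside : ∀ i → S (a′ i) ≡ true
      inside (σ ∷ i) = ∩-⊑ˡ {S = S} {T = side σ (φ c b)} (proj₁ (proj₂ (spec σ)) i)
      agrees : ∀ i (d : Fin (suc h)) → φ c (b′ (take (toℕ d) (toList i))) (a′ i) ≡ lookup i d
      agrees (σ ∷ i) zero    =
        side-true σ (φ c b) (∩-⊑ʳ {S = S} {T = side σ (φ c b)} (proj₁ (proj₂ (spec σ)) i))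
      agrees (σ ∷ i) (suc d) = proj₂ (proj₂ (spec σ)) i d

    half≢∅ : ∀ {a} {S T : Sub N} → ∣ S ∣ < a * ∣ S ∩ T ∣ → 0 < ∣ S ∩ T ∣
    half≢∅ {a} {S} {T} lt with ∣ S ∩ T ∣
    ... | zero  = ⊥-elim (n≮0 (subst (∣ S ∣ <_) (*-zeroʳ a) lt))
    ... | suc _ = z<s

    Split⇒Shatter : ∀ {a S} ((c , _) : Split a S) → Shatter c 1 S
    Split⇒Shatter {a} {S} (c , b , split) = node b λ σ →
      let x , x∈ = nonempty {S = S ∩ side σ (φ c b)} (half≢∅ {a} {S} {side σ (φ c b)} (split σ)) in leaf x x∈

    -- After a split of colour `c`, trees of that colour in both halves gain a level from the root,
    -- so the height demanded of `c` inside the halves drops by one. Other colours gain nothing.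
    lower : C → (C → ℕ) → C → ℕ
    lower c h y with c ≟C y
    ... | yes _ = pred (h y)
    ... | no  _ = h y

    lower-≡ : ∀ c h → lower c h c ≡ pred (h c)
    lower-≡ c h with c ≟C c
    ... | yes _   = refl
    ... | no  c≢c = ⊥-elim (c≢c refl)

    lower-≢ : ∀ {c y} h → c ≢ y → lower c h y ≡ h y
    lower-≢ {c} {y} h c≢y with c ≟C y
    ... | yes c≡y = ⊥-elim (c≢y c≡y)
    ... | no  _   = refl

    lower-≤ : ∀ c h y → lower c h y ≤ h y
    lower-≤ c h y with c ≟C y
    ... | yes _ = pred[n]≤n
    ... | no  _ = ≤-refl

    -- Splitting subsets that are not good grows a binary tree whose nodes are coloured by C.  If it
    -- reaches height d + 1, then Ramsey's theorem for trees yields a colour c with a monochromatic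
    -- subtree of height h c + 1; the recursion runs both arguments at once.
    good-subset : ∀ a .{{_ : NonZero a}} d (h : C → ℕ) S → ∑ cs h ≤ d → 0 < ∣ S ∣ →
      (∃ λ T → T ⊑ S × Good a T × ∣ S ∣ ≤ a ^ d * ∣ T ∣) ⊎ (∃ λ c → Shatter c (suc (h c)) S)
    good-subset a d h S ∑≤d S≢∅ with good? a S
    ... | inj₁ good = inj₁ (S , (λ eq → eq) , good , m≤n*m ∣ S ∣ (a ^ d) {{m^n≢0 a d}})
    ... | inj₂ (c , b , split) = descend d ∑≤d (h c) refl
      where
      half : Bool → Sub N
      half σ = S ∩ side σ (φ c b)

      descend : ∀ d → ∑ cs h ≤ d → ∀ n → h c ≡ n →
        (∃ λ T → T ⊑ S × Good a T × ∣ S ∣ ≤ a ^ d * ∣ T ∣) ⊎ (∃ λ c → Shatter c (suc (h c)) S)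
      -- Height 1 is demanded of `c`, and the split itself is such a tree.
      descend d ∑≤d zero eq = inj₂ (c , subst (λ n → Shatter c (suc n) S) (sym eq)
        (Split⇒Shatter {a} {S} (c , b , split)))
      descend zero ∑≤0 (suc n) eq = ⊥-elim (n≮0 (≤-trans (subst (_≤ ∑ cs h) eq (∑-∈ h (∈cs c))) ∑≤0))
      descend (suc d) ∑≤d (suc n) eq = combine (rec true) (rec false)
        where
        h′ = lower c h
        hc : h′ c ≡ n
        hc = trans (lower-≡ c h) (cong pred eq)
        ∑h′≤d : ∑ cs h′ ≤ d
        ∑h′≤d = s≤s⁻¹ (≤-trans (∑-mono-< (lower-≤ c h) (∈cs c)
          (subst₂ _<_ (sym hc) (sym eq) (n<1+n n))) ∑≤d)
        Outcome : Set
        Outcome = (∃ λ T → T ⊑ S × Good a T × ∣ S ∣ ≤ a ^ suc d * ∣ T ∣) ⊎ (∃ λ c → Shatter c (suc (h c)) S)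
        -- A tree of another colour already has the height demanded in `S`. A tree of colour `c` is
        -- one level short and must wait for its twin in the other half.
        classify : ∀ {σ c′} → Dec (c ≡ c′) → Shatter c′ (suc (h′ c′)) (half σ) → Outcome ⊎ Shatter c (h c) (half σ)
        classify {σ} (yes refl) tree =
          inj₂ (subst (λ n → Shatter c n (half σ)) (trans (cong suc hc) (sym eq)) tree)
        classify {σ} {c′} (no c≢c′) tree = inj₁ (inj₂ (c′ ,
          Shatter-mono (∩-⊑ˡ {S = S} {T = side σ (φ c b)})
            (subst (λ n → Shatter c′ (suc n) (half σ)) (lower-≢ h c≢c′) tree)))
        rec : ∀ σ → Outcome ⊎ Shatter c (h c) (half σ)
        rec σ with good-subset a d h′ (half σ) ∑h′≤d (half≢∅ {a} {S} {side σ (φ c b)} (split σ))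
        ... | inj₁ (T , T⊑ , good , le) = inj₁ (inj₁ (T , (λ eq′ → ∩-⊑ˡ {S = S} {T = side σ (φ c b)} (T⊑ eq′)) , good , (begin
                ∣ S ∣                     ≤⟨ <⇒≤ (split σ) ⟩
                a * ∣ half σ ∣            ≤⟨ *-monoʳ-≤ a le ⟩
                a * (a ^ d * ∣ T ∣)       ≡⟨ *-assoc a (a ^ d) ∣ T ∣ ⟨
                a ^ suc d * ∣ T ∣         ∎)))
          where open ≤-Reasoning
        ... | inj₂ (c′ , tree) = classify {σ} (c ≟C c′) tree
        combine : Outcome ⊎ Shatter c (h c) (half true) → Outcome ⊎ Shatter c (h c) (half false) → Outcome
        combine (inj₁ o) _        = o
        combine (inj₂ _) (inj₁ o) = o
        combine (inj₂ t) (inj₂ f) = inj₂ (c , node b λ { true → t ; false → f })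

  -- Sampling

  -- Multiplicative weights: elements are added one at a time, by averaging, so that no step multiplies
  -- the potential ∑ᵢ wᵢ 2^∣T ∩ Sᵢ∣ by more than 1 + 1/β.
  sample : ∀ {N} {I : Set} (is : List I) (S : I → Sub N) β m (A : Sub N) (w : I → ℕ) →
    m ≤ ∣ A ∣ → (∀ i → β * ∣ A ∩ S i ∣ + m ≤ ∣ A ∣) →
    ∃ λ T → T ⊑ A × ∣ T ∣ ≡ m ×
      β ^ m * ∑ is (λ i → w i * 2 ^ ∣ T ∩ S i ∣) ≤ suc β ^ m * ∑ is w
  sample {N} is S β zero A w _ _ = ∅ , (λ ()) , ∑-zero (allFin N) ,
    ≤-reflexive (cong (1 *_) (∑-cong is (λ i → trans (cong (λ n → w i * 2 ^ n) (∑-zero (allFin N))) (*-identityʳ (w i)))))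
    where
    ∅ : Sub N
    ∅ _ = false
  sample {N} is S β (suc m) A w m≤A sparse
    with average {S = A} {W = ∑ is w} (λ x → β * ∑ is (λ i → w i * 𝟙 (S i x))) (≤-trans z<s m≤A) load
    where
    open ≤-Reasoning
    xs = allFin N
    load : ∑ xs (λ x → 𝟙 (A x) * (β * ∑ is (λ i → w i * 𝟙 (S i x)))) ≤ ∣ A ∣ * ∑ is w
    load = begin
      ∑ xs (λ x → 𝟙 (A x) * (β * ∑ is (λ i → w i * 𝟙 (S i x))))
        ≡⟨ ∑-cong xs (λ x → trans (sym (*-assoc (𝟙 (A x)) β _)) (sym (∑-*ˡ is (𝟙 (A x) * β) _))) ⟩
      ∑ xs (λ x → ∑ is (λ i → 𝟙 (A x) * β * (w i * 𝟙 (S i x))))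
        ≡⟨ ∑-swap xs is _ ⟩
      ∑ is (λ i → ∑ xs (λ x → 𝟙 (A x) * β * (w i * 𝟙 (S i x))))
        ≡⟨ ∑-cong is (λ i → trans (∑-cong xs (λ x → pw (A x) (S i x) (w i))) (∑-*ˡ xs (w i * β) _)) ⟩
      ∑ is (λ i → w i * β * ∣ A ∩ S i ∣)
        ≤⟨ ∑-mono is (λ i → ≤-trans (≤-reflexive (*-assoc (w i) β _))
             (*-monoʳ-≤ (w i) (≤-trans (m≤m+n _ _) (sparse i)))) ⟩
      ∑ is (λ i → w i * ∣ A ∣)
        ≡⟨ trans (∑-*ʳ is ∣ A ∣ w) (*-comm _ ∣ A ∣) ⟩
      ∣ A ∣ * ∑ is w ∎
      where
      shuffle : ∀ a β v s → a * β * (v * s) ≡ v * β * (a * s)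
      shuffle = solve-∀
      pw : ∀ a s v → 𝟙 a * β * (v * 𝟙 s) ≡ v * β * 𝟙 (a ∧ s)
      pw a s v = trans (shuffle (𝟙 a) β v (𝟙 s)) (cong (v * β *_) (sym (𝟙-∧ a s)))
  ... | x , x∈A , light
    -- A weight doubles when `x` hits its test, so the weights carry 2 to the number of hits so far.
    with sample is S β m (A ∖ x) (λ i → w i * 2 ^ 𝟙 (S i x))
           (s≤s⁻¹ (subst (suc m ≤_) (∣∖∣ {S = A} x∈A) m≤A)) sparse′
    where
    -- The size of the pool and the number of draws left both drop by one; the summand `m` is the
    -- slack that preserves sparseness until the last draw.
    sparse′ : ∀ i → β * ∣ (A ∖ x) ∩ S i ∣ + m ≤ ∣ A ∖ x ∣
    sparse′ i = s≤s⁻¹ (begin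
      suc (β * ∣ (A ∖ x) ∩ S i ∣ + m)  ≡⟨ +-suc _ m ⟨
      β * ∣ (A ∖ x) ∩ S i ∣ + suc m    ≤⟨ +-monoˡ-≤ (suc m) (*-monoʳ-≤ β (∣∣-mono {S = (A ∖ x) ∩ S i} {T = A ∩ S i}
                                            (∩-monoˡ {S = A ∖ x} {S′ = A} {T = S i} (∩-⊑ˡ {S = A} {T = λ y → not (does (x ≟ᶠ y))})))) ⟩
      β * ∣ A ∩ S i ∣ + suc m          ≤⟨ sparse i ⟩
      ∣ A ∣                            ≡⟨ ∣∖∣ {S = A} x∈A ⟩
      suc ∣ A ∖ x ∣                    ∎)
      where open ≤-Reasoning
  ... | T , T⊑ , ∣T∣≡m , bound = T⁺ , T⁺⊑A , trans (∣∣-point {S = T} {T = T⁺} x 1 pw₁) (trans (+-comm ∣ T ∣ 1) (cong suc ∣T∣≡m)) , bound⁺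
    where
    open ≤-Reasoning
    T⁺ : Sub N
    -- The union of `T` and the point `x`, by De Morgan. As `T` avoids `x`, every count grows by
    -- exactly the indicator of `x`.
    T⁺ y = not (not (T y) ∧ not (does (x ≟ᶠ y)))
    Tx : T x ≡ false
    Tx with T x in eq
    ... | false = refl
    ... | true with A x | x ≟ᶠ x | T⊑ {x} eq
    ...   | true  | yes _   | ()
    ...   | true  | no  x≢x | _ = ⊥-elim (x≢x refl)
    T⁺⊑A : T⁺ ⊑ A
    T⁺⊑A {y} eq with T y in Ty | x ≟ᶠ y
    ... | true  | _        = ∩-⊑ˡ {S = A} {T = λ z → not (does (x ≟ᶠ z))} (T⊑ Ty)
    ... | false | yes refl = x∈A
    pw₁ : ∀ y → 𝟙 (T⁺ y) ≡ 𝟙 (T y) + 𝟙 (does (x ≟ᶠ y)) * 1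
    pw₁ y with x ≟ᶠ y
    ... | yes refl rewrite Tx = refl
    ... | no  _ with T y
    ...   | true  = refl
    ...   | false = refl
    pw : ∀ i y → 𝟙 (T⁺ y ∧ S i y) ≡ 𝟙 (T y ∧ S i y) + 𝟙 (does (x ≟ᶠ y)) * 𝟙 (S i x)
    pw i y with x ≟ᶠ y
    ... | yes refl rewrite Tx = sym (*-identityˡ (𝟙 (S i x)))
    ... | no  _ with T y
    ...   | true  = sym (+-identityʳ _)
    ...   | false = refl
    gain : ∀ i → w i * 2 ^ ∣ T⁺ ∩ S i ∣ ≡ w i * 2 ^ 𝟙 (S i x) * 2 ^ ∣ T ∩ S i ∣
    gain i = trans (cong (λ n → w i * 2 ^ n) (trans (∣∣-point {S = T ∩ S i} {T = T⁺ ∩ S i} x _ (pw i)) (+-comm _ (𝟙 (S i x)))))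
      (trans (cong (w i *_) (^-distribˡ-+-* 2 (𝟙 (S i x)) ∣ T ∩ S i ∣)) (sym (*-assoc (w i) _ _)))
    -- Doubling is linear in the indicator, so the average bound `light` controls the new potential.
    double : ∀ v b → v * 2 ^ 𝟙 b ≡ v + v * 𝟙 b
    double v true  = double-one v
      where
      double-one : ∀ v → v * 2 ≡ v + v * 1
      double-one = solve-∀
    double v false = trans (*-identityʳ v) (sym (trans (cong (v +_) (*-zeroʳ v)) (+-identityʳ v)))
    bound⁺ : β ^ suc m * ∑ is (λ i → w i * 2 ^ ∣ T⁺ ∩ S i ∣) ≤ suc β ^ suc m * ∑ is w
    bound⁺ = begin
      β ^ suc m * ∑ is (λ i → w i * 2 ^ ∣ T⁺ ∩ S i ∣)
        ≡⟨ cong (β ^ suc m *_) (∑-cong is gain) ⟩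
      β ^ suc m * ∑ is (λ i → w i * 2 ^ 𝟙 (S i x) * 2 ^ ∣ T ∩ S i ∣)
        ≡⟨ *-assoc β (β ^ m) _ ⟩
      β * (β ^ m * ∑ is (λ i → w i * 2 ^ 𝟙 (S i x) * 2 ^ ∣ T ∩ S i ∣))
        ≤⟨ *-monoʳ-≤ β bound ⟩
      β * (suc β ^ m * ∑ is (λ i → w i * 2 ^ 𝟙 (S i x)))
        ≡⟨ cong (λ v → β * (suc β ^ m * v)) (trans (∑-cong is (λ i → double (w i) (S i x))) (∑-+ is w _)) ⟩
      β * (suc β ^ m * (∑ is w + ∑ is (λ i → w i * 𝟙 (S i x))))
        ≡⟨ shuffle β (suc β ^ m) (∑ is w) _ ⟩
      suc β ^ m * (β * ∑ is w + β * ∑ is (λ i → w i * 𝟙 (S i x)))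
        ≤⟨ *-monoʳ-≤ (suc β ^ m) (+-monoʳ-≤ (β * ∑ is w) light) ⟩
      suc β ^ m * (β * ∑ is w + ∑ is w)
        ≡⟨ collect β (suc β ^ m) (∑ is w) ⟩
      suc β ^ suc m * ∑ is w ∎
      where
      shuffle : ∀ a b c d → a * (b * (c + d)) ≡ b * (a * c + a * d)
      shuffle = solve-∀
      collect : ∀ a b c → b * (a * c + c) ≡ (1 + a) * b * c
      collect = solve-∀

  -- A division-free form of (1 + 1/c)^j ≤ 1/(1 - j/c). The induction step is (c + 1)k ≤ c(k + 1)
  -- for k = c - j - 1, which holds because k ≤ c.
  reverse-bernoulli : ∀ c j → j ≤ c → suc c ^ j * (c ∸ j) ≤ c ^ suc j
  reverse-bernoulli c zero    _   = ≤-reflexive (trans (*-identityˡ c) (sym (*-identityʳ c)))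
  reverse-bernoulli c (suc j) j<c with m≤n⇒∃[o]m+o≡n j<c
  ... | k , refl = begin
    suc c ^ suc j * (c ∸ suc j)     ≡⟨ cong (suc c ^ suc j *_) (m+n∸m≡n (suc j) k) ⟩
    suc c ^ suc j * k               ≡⟨ cong (_* k) (*-comm (suc c) (suc c ^ j)) ⟩
    suc c ^ j * suc c * k           ≡⟨ *-assoc (suc c ^ j) (suc c) k ⟩
    suc c ^ j * (suc c * k)         ≤⟨ *-monoʳ-≤ (suc c ^ j) step ⟩
    suc c ^ j * (c * suc k)         ≡⟨ shuffle (suc c ^ j) c (suc k) ⟩
    c * (suc c ^ j * suc k)         ≡⟨ cong (λ n → c * (suc c ^ j * n)) c∸j ⟨
    c * (suc c ^ j * (c ∸ j))       ≤⟨ *-monoʳ-≤ c (reverse-bernoulli c j (<⇒≤ j<c)) ⟩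
    c ^ suc (suc j)                 ∎
    where
    open ≤-Reasoning
    shuffle : ∀ a b d → a * (b * d) ≡ b * (a * d)
    shuffle = solve-∀
    c∸j : suc (j + k) ∸ j ≡ suc k
    c∸j = trans (cong (_∸ j) (sym (+-suc j k))) (m+n∸m≡n j (suc k))
    step : suc c * k ≤ c * suc k
    step = begin
      k + c * k      ≤⟨ +-monoˡ-≤ (c * k) (m≤n+m k (suc j)) ⟩
      c + c * k      ≡⟨ *-suc c k ⟨
      c * suc k      ∎

  [1+2b]^b≤2[2b]^b : ∀ b .{{_ : NonZero b}} → suc (2 * b) ^ b ≤ 2 * (2 * b) ^ b
  [1+2b]^b≤2[2b]^b b = *-cancelʳ-≤ _ _ b (begin
    suc (2 * b) ^ b * b              ≡⟨ cong (suc (2 * b) ^ b *_) 2b∸b ⟨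
    suc (2 * b) ^ b * (2 * b ∸ b)    ≤⟨ reverse-bernoulli (2 * b) b (m≤m+n b (b + 0)) ⟩
    2 * b * (2 * b) ^ b              ≡⟨ shuffle b ((2 * b) ^ b) ⟩
    2 * (2 * b) ^ b * b              ∎)
    where
    open ≤-Reasoning
    shuffle : ∀ a c → 2 * a * c ≡ 2 * c * a
    shuffle = solve-∀
    2b∸b : 2 * b ∸ b ≡ b
    2b∸b = trans (m+n∸m≡n b (b + 0)) (+-identityʳ b)

  ^-distribʳ-* : ∀ n x y → (x * y) ^ n ≡ x ^ n * y ^ n
  ^-distribʳ-* zero    x y = refl
  ^-distribʳ-* (suc n) x y = trans (cong (x * y *_) (^-distribʳ-* n x y)) (mix x y (x ^ n) (y ^ n))
    where
    mix : ∀ a b c d → a * b * (c * d) ≡ a * c * (b * d)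
    mix = solve-∀

  -- With β = 2b and m = bu the potential starts at `length is ≤ 2 ^ u` and grows by at most (1 +
  -- 1/2b)^(bu) ≤ 2^u. Each single term 2^∣T ∩ S i∣ is therefore at most 2^(2u).
  sample-sparse : ∀ {N} {I : Set} (is : List I) (S : I → Sub N) b .{{_ : NonZero b}} u (A : Sub N) →
    length is ≤ 2 ^ u → 2 * (b * u) ≤ ∣ A ∣ → (∀ i → 4 * b * ∣ A ∩ S i ∣ ≤ ∣ A ∣) →
    ∃ λ T → T ⊑ A × ∣ T ∣ ≡ b * u × (∀ {i} → i ∈ is → ∣ T ∩ S i ∣ ≤ 2 * u)
  sample-sparse {N} is S b u A few 2m≤A sparse
    with sample is S (2 * b) (b * u) A (λ _ → 1) (≤-trans (m≤m+n (b * u) _) 2m≤A) sparse′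
    where
    -- One half of `∣ A ∣` pays for the exceptions, the other half for the `b * u` draws.
    sparse′ : ∀ i → 2 * b * ∣ A ∩ S i ∣ + b * u ≤ ∣ A ∣
    sparse′ i = *-cancelˡ-≤ 2 (begin
      2 * (2 * b * s + b * u)       ≡⟨ shuffle b u s ⟩
      4 * b * s + 2 * (b * u)       ≤⟨ +-mono-≤ (sparse i) 2m≤A ⟩
      ∣ A ∣ + ∣ A ∣                 ≡⟨ cong (∣ A ∣ +_) (+-identityʳ _) ⟨
      2 * ∣ A ∣                     ∎)
      where
      open ≤-Reasoning
      s = ∣ A ∩ S i ∣
      shuffle : ∀ b u s → 2 * (2 * b * s + b * u) ≡ 4 * b * s + 2 * (b * u)
      shuffle = solve-∀
  ... | T , T⊑A , ∣T∣≡m , bound = T , T⊑A , ∣T∣≡m , λ {i} i∈ → small i i∈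
    where
    open ≤-Reasoning
    X = (2 * b) ^ (b * u)
    instance
      X≢0 : NonZero X
      X≢0 = m^n≢0 (2 * b) (b * u) {{m*n≢0 2 b}}
    total : ∑ is (λ i → 1 * 2 ^ ∣ T ∩ S i ∣) ≤ 2 ^ (2 * u)
    total = *-cancelˡ-≤ X (begin
      X * ∑ is (λ i → 1 * 2 ^ ∣ T ∩ S i ∣)        ≤⟨ bound ⟩
      suc (2 * b) ^ (b * u) * ∑ is (λ _ → 1)      ≡⟨ cong₂ _*_ (sym (^-*-assoc (suc (2 * b)) b u)) (∑-one is) ⟩
      (suc (2 * b) ^ b) ^ u * length is           ≤⟨ *-mono-≤ (^-monoˡ-≤ u ([1+2b]^b≤2[2b]^b b)) few ⟩
      (2 * (2 * b) ^ b) ^ u * 2 ^ u               ≡⟨ cong (_* 2 ^ u) (trans (^-distribʳ-* u 2 ((2 * b) ^ b)) (cong (2 ^ u *_) (^-*-assoc (2 * b) b u))) ⟩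
      2 ^ u * X * 2 ^ u                           ≡⟨ shuffle (2 ^ u) X ⟩
      X * (2 ^ u * 2 ^ u)                         ≡⟨ cong (X *_) (^-distribˡ-+-* 2 u u) ⟨
      X * 2 ^ (u + u)                             ≡⟨ cong (λ n → X * 2 ^ (u + n)) (+-identityʳ u) ⟨
      X * 2 ^ (2 * u)                             ∎)
      where
      shuffle : ∀ a x → a * x * a ≡ x * (a * a)
      shuffle = solve-∀
    small : ∀ i → i ∈ is → ∣ T ∩ S i ∣ ≤ 2 * u
    small i i∈ = ≮⇒≥ λ lt → <⇒≱ (^-monoʳ-< 2 (s≤s (s≤s z≤n)) lt) (begin
      2 ^ ∣ T ∩ S i ∣                       ≡⟨ *-identityˡ _ ⟨
      1 * 2 ^ ∣ T ∩ S i ∣                   ≤⟨ ∑-∈ (λ i → 1 * 2 ^ ∣ T ∩ S i ∣) i∈ ⟩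
      ∑ is (λ i → 1 * 2 ^ ∣ T ∩ S i ∣)      ≤⟨ total ⟩
      2 ^ (2 * u)                           ∎)

  -- Equitable partitions into good parts

  argmin : ∀ (f : ℕ → ℕ) r .{{_ : NonZero r}} → ∃ λ p → p < r × (∀ q → q < r → f p ≤ f q)
  argmin f (suc zero) = 0 , z<s , λ { zero _ → ≤-refl ; (suc _) (s≤s ()) }
  argmin f (suc r@(suc _)) with argmin f r
  ... | p , p<r , min with f p ≤? f r
  ...   | yes fp≤fr = p , m<n⇒m<1+n p<r , least
    where
    least : ∀ q → q < suc r → f p ≤ f q
    least q q≤r with m≤n⇒m<n∨m≡n (s≤s⁻¹ q≤r)
    ... | inj₁ q<r  = min q q<r
    ... | inj₂ refl = fp≤fr
  ...   | no fp≰fr = r , n<1+n r , least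
    where
    least : ∀ q → q < suc r → f r ≤ f q
    least q q≤r with m≤n⇒m<n∨m≡n (s≤s⁻¹ q≤r)
    ... | inj₁ q<r  = ≤-trans (<⇒≤ (≰⇒> fp≰fr)) (min q q<r)
    ... | inj₂ refl = ≤-refl

  ≡ᵇ-true : ∀ {a b} → (a ≡ᵇ b) ≡ true → a ≡ b
  ≡ᵇ-true {a} {b} eq with a ≟ b
  ... | yes a≡b = a≡b
  ... | no  a≢b = case trans (sym eq) (dec-false (a ≟ b) a≢b) of λ ()

  ≡⇒≡ᵇ-true : ∀ {a b} → a ≡ b → (a ≡ᵇ b) ≡ true
  ≡⇒≡ᵇ-true {a} {b} = dec-true (a ≟ b)

  ≢⇒≡ᵇ-false : ∀ {a b} → a ≢ b → (a ≡ᵇ b) ≡ false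
  ≢⇒≡ᵇ-false {a} {b} = dec-false (a ≟ b)

  module _ {N : ℕ} where

    -- Labels are natural numbers while blocks are still being cut off: label `r` marks the
    -- remainder, and `r` can grow without a change of type. `class` is the counterpart for the
    -- finished partition.
    cell : (Fin N → ℕ) → ℕ → Sub N
    cell κ p x = κ x ≡ᵇ p

    class : ∀ {r} → (Fin N → Fin r) → Fin r → Sub N
    class part p x = does (part x ≟ᶠ p)

    partSize≡∣class∣ : ∀ {r} (part : Fin N → Fin r) p → partSize part p ≡ ∣ class part p ∣
    partSize≡∣class∣ part p = length-filter≡∑ (λ x → part x ≟ᶠ p) (allFin N)

    ∑∣class∣ : ∀ {r} (part : Fin N → Fin r) → ∑ (allFin r) (λ p → ∣ class part p ∣) ≡ N
    ∑∣class∣ {r} part = trans (∑-swap (allFin r) (allFin N) _)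
      (trans (∑-cong (allFin N) (λ x → ∑-δ (part x))) ∣full∣)

  module Regularity {N : ℕ} {C : Set} (_≟C_ : DecidableEquality C)
                    (cs : List C) (∈cs : ∀ c → c ∈ cs)
                    {P : C → Set} (ps : ∀ c → List (P c)) (∈ps : ∀ c (b : P c) → b ∈ ps c)
                    (φ : ∀ c → P c → Sub N) where

    open Tests _≟C_ cs ∈cs ps ∈ps φ

    Sparse : ℕ → Sub N → Set
    Sparse θ S = ∀ c b → ∃ λ σ → ∣ S ∩ side σ (φ c b) ∣ ≤ θ

    ∣∩∣-cong : ∀ {S S′ : Sub N} T → (∀ x → S x ≡ S′ x) → ∣ S ∩ T ∣ ≡ ∣ S′ ∩ T ∣
    ∣∩∣-cong {S} {S′} T eq = ∣∣-cong {S = S ∩ T} {T = S′ ∩ T} (λ x → cong (_∧ T x) (eq x))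

    Sparse-cong : ∀ {θ} {S S′ : Sub N} → (∀ x → S x ≡ S′ x) → Sparse θ S → Sparse θ S′
    Sparse-cong {θ} {S} {S′} eq sparse c b with sparse c b
    ... | σ , le = σ , subst (_≤ θ) (∣∩∣-cong {S = S} {S′ = S′} (side σ (φ c b)) eq) le

    tests : List (Σ C P)
    tests = concatMap (λ c → map (c ,_) (ps c)) cs

    ∈tests : ∀ {c} (b : P c) → (c , b) ∈ tests
    ∈tests {c} b = ∈-concatMap⁺ _ (Any.map (λ { refl → ∈-map⁺ (c ,_) (∈ps c b) }) (∈cs c))

    length-tests : length tests ≡ ∑ cs (length ∘ ps)
    length-tests = trans (sym (∑-one tests)) (trans (∑-concatMap _ cs _)
      (∑-cong cs λ c → trans (∑-map {B = Σ C P} (c ,_) (ps c) (λ _ → 1)) (∑-one (ps c))))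

    -- One sample treats all tests at once. The exceptional density rises from 1/4b to 2u/bu = 2/b,
    -- a loss of a factor 8.
    sparse-block : ∀ b .{{_ : NonZero b}} u T → length tests ≤ 2 ^ u → 2 * (b * u) ≤ ∣ T ∣ → Good (4 * b) T →
                   ∃ λ B → B ⊑ T × ∣ B ∣ ≡ b * u × Sparse (2 * u) B
    sparse-block b u T few large good =
      let B , B⊑T , ∣B∣≡m , sparse = sample-sparse tests minority b u T few large (λ (c , t) → proj₂ (good c t))
      in B , B⊑T , ∣B∣≡m , λ c t → proj₁ (good c t) , sparse (∈tests t)
      where
      minority : Σ C P → Sub N
      minority (c , t) = side (proj₁ (good c t)) (φ c t)

    module _ (m θ : ℕ) where

      record Stripped (κ : Fin N → ℕ) (r : ℕ) : Set where
        field
          bounded : ∀ x → κ x ≤ r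
          size    : ∀ p → p < r → ∣ cell κ p ∣ ≡ m
          sparse  : ∀ p → p < r → Sparse θ (cell κ p)
          total   : r * m + ∣ cell κ r ∣ ≡ N

      open Stripped

      strip-one : ∀ {κ r} → Stripped κ r → ∀ B → B ⊑ cell κ r → ∣ B ∣ ≡ m → Sparse θ B →
                  ∃ λ κ′ → Stripped κ′ (suc r) × m + ∣ cell κ′ (suc r) ∣ ≡ ∣ cell κ r ∣
      strip-one {κ} {r} inv B B⊑ ∣B∣≡m B-sparse = κ′ , record
        { bounded = bounded′
        ; size    = λ p p<1+r → size′ p (m≤n⇒m<n∨m≡n (s≤s⁻¹ p<1+r))
        ; sparse  = λ p p<1+r → sparse′ p (m≤n⇒m<n∨m≡n (s≤s⁻¹ p<1+r))
        ; total   = trans (cong (_+ ∣ cell κ′ (suc r) ∣) (+-comm m (r * m)))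
                      (trans (+-assoc (r * m) m _) (trans (cong (r * m +_) rest) (total inv)))
        } , rest
        where
        κ′ : Fin N → ℕ
        -- `B` keeps the label `r` and becomes a block; what is left of the remainder moves on to
        -- `suc r`, and earlier blocks are untouched.
        κ′ x = if (κ x ≡ᵇ r) ∧ not (B x) then suc r else κ x
        bounded′ : ∀ x → κ′ x ≤ suc r
        bounded′ x with (κ x ≡ᵇ r) ∧ not (B x)
        ... | true  = ≤-refl
        ... | false = m≤n⇒m≤1+n (bounded inv x)
        old : ∀ {p} → p < r → ∀ x → cell κ p x ≡ cell κ′ p x
        old {p} p<r x with κ x ≡ᵇ r in κx | B x
        ... | false | _     = refl
        ... | true  | true  = refl
        ... | true  | false = trans (≢⇒≡ᵇ-false (λ eq → <-irrefl (trans (sym eq) (≡ᵇ-true {κ x} κx)) p<r))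
                                    (sym (≢⇒≡ᵇ-false (λ eq → <-asym p<r (≤-reflexive eq))))
        new : ∀ x → B x ≡ cell κ′ r x
        new x with κ x ≡ᵇ r in κx | B x in Bx
        ... | true  | true  = sym κx
        ... | true  | false = sym (≢⇒≡ᵇ-false {suc r} {r} 1+n≢n)
        ... | false | true  = trans (sym (B⊑ Bx)) refl
        ... | false | false = sym κx
        left : ∀ x → (cell κ r ∩ (not ∘ B)) x ≡ cell κ′ (suc r) x
        left x with κ x ≡ᵇ r in κx | B x
        ... | true  | true  = sym (≢⇒≡ᵇ-false (λ eq → 1+n≢n (trans (sym eq) (≡ᵇ-true {κ x} {r} κx))))
        ... | true  | false = sym (≡⇒≡ᵇ-true {suc r} refl)
        ... | false | _     = sym (≢⇒≡ᵇ-false (λ eq → <-irrefl eq (s≤s (bounded inv x))))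
        size′ : ∀ p → p < r ⊎ p ≡ r → ∣ cell κ′ p ∣ ≡ m
        size′ p (inj₁ p<r) = trans (sym (∣∣-cong {S = cell κ p} {T = cell κ′ p} (old p<r))) (size inv p p<r)
        size′ p (inj₂ refl) = trans (sym (∣∣-cong {S = B} {T = cell κ′ r} new)) ∣B∣≡m
        sparse′ : ∀ p → p < r ⊎ p ≡ r → Sparse θ (cell κ′ p)
        sparse′ p (inj₁ p<r) = Sparse-cong {S = cell κ p} {S′ = cell κ′ p} (old p<r) (sparse inv p p<r)
        sparse′ p (inj₂ refl) = Sparse-cong {S = B} {S′ = cell κ′ r} new B-sparse
        common : ∣ cell κ r ∩ B ∣ ≡ m
        common = trans (∣∣-cong {S = cell κ r ∩ B} {T = B} pw) ∣B∣≡m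
          where
          pw : ∀ x → cell κ r x ∧ B x ≡ B x
          pw x with B x in Bx
          ... | true  rewrite B⊑ Bx = refl
          ... | false with cell κ r x
          ...   | true  = refl
          ...   | false = refl
        rest : m + ∣ cell κ′ (suc r) ∣ ≡ ∣ cell κ r ∣
        rest = sym (trans (∣∣-split (cell κ r) B)
          (cong₂ _+_ common (∣∣-cong {S = cell κ r ∩ (not ∘ B)} {T = cell κ′ (suc r)} left)))

      -- Each block takes `m > 0` elements from the remainder, so its size bound `n` decreases. The
      -- process stops when the remainder is too small for `pull`.
      strip : ∀ w → 0 < m →
        (∀ S → N ≤ w * ∣ S ∣ → ∃ λ B → B ⊑ S × ∣ B ∣ ≡ m × Sparse θ B) →
        ∀ n κ r → Stripped κ r → ∣ cell κ r ∣ ≤ n →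
        ∃ λ κ′ → ∃ λ r′ → Stripped κ′ r′ × w * ∣ cell κ′ r′ ∣ < N
      strip w m>0 pull n κ r inv ≤n with w * ∣ cell κ r ∣ <? N
      ... | yes lt = κ , r , inv , lt
      ... | no ≮N with pull (cell κ r) (≮⇒≥ ≮N)
      ...   | B , B⊑ , ∣B∣≡m , sp with strip-one inv B B⊑ ∣B∣≡m sp
      ...     | κ′ , inv′ , rest = next n ≤n
        where
        shrink : ∣ cell κ′ (suc r) ∣ < ∣ cell κ r ∣
        shrink = ≤-trans (+-monoˡ-≤ _ m>0) (≤-reflexive rest)
        next : ∀ n → ∣ cell κ r ∣ ≤ n → _
        next zero    ≤0 = ⊥-elim (n≮0 (≤-trans shrink ≤0))
        next (suc n) ≤n = strip w m>0 pull n κ′ (suc r) inv′ (s≤s⁻¹ (≤-trans shrink ≤n))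

      -- The field `sparse` allows θ exceptions plus one for each element beyond the original `m`:
      -- any element added later may be exceptional for every test. Written with sums, it avoids
      -- subtraction.
      record Balanced (κ : Fin N → ℕ) (r : ℕ) : Set where
        field
          bounded   : ∀ x → κ x ≤ r
          equitable : ∀ p q → p < r → q < r → ∣ cell κ p ∣ ≤ suc ∣ cell κ q ∣
          large     : ∀ p → p < r → m ≤ ∣ cell κ p ∣
          sparse    : ∀ p → p < r → ∀ c b → ∃ λ σ → ∣ cell κ p ∩ side σ (φ c b) ∣ + m ≤ θ + ∣ cell κ p ∣

      Stripped⇒Balanced : ∀ {κ r} → Stripped κ r → Balanced κ r
      Stripped⇒Balanced inv = record
        { bounded   = bounded inv
        ; equitable = λ p q p<r q<r → ≤-trans (≤-reflexive (trans (size inv p p<r) (sym (size inv q q<r)))) (n≤1+n _)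
        ; large     = λ p p<r → ≤-reflexive (sym (size inv p p<r))
        ; sparse    = λ p p<r c b → let σ , le = sparse inv p p<r c b in
                        σ , +-mono-≤ le (≤-reflexive (sym (size inv p p<r)))
        }

      -- Feeding a smallest cell keeps the sizes within 1 of each other, and a new exception on the
      -- left of `sparse` is matched by the larger cell on the right.
      insert : ∀ {κ r} → Balanced κ r → ∀ x → κ x ≡ r → ∀ p → p < r →
        (∀ q → q < r → ∣ cell κ p ∣ ≤ ∣ cell κ q ∣) →
        ∃ λ κ′ → Balanced κ′ r × ∣ cell κ r ∣ ≡ suc ∣ cell κ′ r ∣
      insert {κ} {r} inv x κx≡r p p<r smallest = κ′ , record
        { bounded   = bounded′
        ; equitable = equitable′
        ; large     = λ q q<r → ≤-trans (B.large q q<r) (≤-trans (m≤m+n _ _) (≤-reflexive (sym (grow q q<r))))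
        ; sparse    = sparse′
        } , trans (∣∣-point {S = cell κ′ r} {T = cell κ r} x 1 leave) (+-comm _ 1)
        where
        module B = Balanced inv
        κ′ : Fin N → ℕ
        κ′ y = if does (x ≟ᶠ y) then p else κ y
        δ : ℕ → ℕ
        δ q = 𝟙 (p ≡ᵇ q)
        bounded′ : ∀ y → κ′ y ≤ r
        bounded′ y with does (x ≟ᶠ y)
        ... | true  = <⇒≤ p<r
        ... | false = B.bounded y
        point : ∀ q → q < r → ∀ T y → 𝟙 (cell κ′ q y ∧ T y) ≡
                𝟙 (cell κ q y ∧ T y) + 𝟙 (does (x ≟ᶠ y)) * 𝟙 ((p ≡ᵇ q) ∧ T x)
        point q q<r T y with x ≟ᶠ y
        ... | no  _ = sym (+-identityʳ _)
        ... | yes refl rewrite ≢⇒≡ᵇ-false {κ x} {q} (λ eq → <-irrefl (trans (sym eq) κx≡r) q<r) =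
                  sym (+-identityʳ _)
        grow∩ : ∀ q → q < r → ∀ T → ∣ cell κ′ q ∩ T ∣ ≡ ∣ cell κ q ∩ T ∣ + 𝟙 ((p ≡ᵇ q) ∧ T x)
        grow∩ q q<r T = ∣∣-point {S = cell κ q ∩ T} {T = cell κ′ q ∩ T} x _ (point q q<r T)
        ∧-true : ∀ a → a ∧ true ≡ a
        ∧-true true  = refl
        ∧-true false = refl
        grow : ∀ q → q < r → ∣ cell κ′ q ∣ ≡ ∣ cell κ q ∣ + δ q
        grow q q<r = trans (∣∣-cong {S = cell κ′ q} {T = cell κ′ q ∩ full} (λ y → sym (∧-true (cell κ′ q y))))
          (trans (grow∩ q q<r full)
            (cong₂ _+_ (∣∣-cong {S = cell κ q ∩ full} {T = cell κ q} (λ y → ∧-true (cell κ q y)))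
                       (cong 𝟙 (∧-true ((p ≡ᵇ q))))))
        leave : ∀ y → 𝟙 (cell κ r y) ≡ 𝟙 (cell κ′ r y) + 𝟙 (does (x ≟ᶠ y)) * 1
        leave y with x ≟ᶠ y
        ... | no  _ = sym (+-identityʳ _)
        ... | yes refl rewrite ≡⇒≡ᵇ-true κx≡r | ≢⇒≡ᵇ-false (<⇒≢ p<r) = refl
        equitable′ : ∀ q q′ → q < r → q′ < r → ∣ cell κ′ q ∣ ≤ suc ∣ cell κ′ q′ ∣
        equitable′ q q′ q<r q′<r rewrite grow q q<r | grow q′ q′<r with p ≡ᵇ q in eq
        ... | true  rewrite sym (≡ᵇ-true {p} eq) =
                      ≤-trans (≤-reflexive (+-comm _ 1)) (s≤s (≤-trans (smallest q′ q′<r) (m≤m+n _ _)))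
        ... | false = ≤-trans (≤-reflexive (+-identityʳ _)) (≤-trans (B.equitable q q′ q<r q′<r) (s≤s (m≤m+n _ _)))
        sparse′ : ∀ q → q < r → ∀ c b → ∃ λ σ → ∣ cell κ′ q ∩ side σ (φ c b) ∣ + m ≤ θ + ∣ cell κ′ q ∣
        sparse′ q q<r c b with B.sparse q q<r c b
        ... | σ , le = σ , (begin
          ∣ cell κ′ q ∩ T ∣ + m              ≡⟨ cong (_+ m) (grow∩ q q<r T) ⟩
          ∣ cell κ q ∩ T ∣ + t + m           ≤⟨ +-monoˡ-≤ m (+-monoʳ-≤ _ (∧-≤ ((p ≡ᵇ q)) (T x))) ⟩
          ∣ cell κ q ∩ T ∣ + δ q + m         ≡⟨ shuffle ∣ cell κ q ∩ T ∣ (δ q) m ⟩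
          ∣ cell κ q ∩ T ∣ + m + δ q         ≤⟨ +-monoˡ-≤ (δ q) le ⟩
          θ + ∣ cell κ q ∣ + δ q             ≡⟨ +-assoc θ _ _ ⟩
          θ + (∣ cell κ q ∣ + δ q)           ≡⟨ cong (θ +_) (grow q q<r) ⟨
          θ + ∣ cell κ′ q ∣                  ∎)
          where
          open ≤-Reasoning
          T = side σ (φ c b)
          t = 𝟙 ((p ≡ᵇ q) ∧ T x)
          ∧-≤ : ∀ a b → 𝟙 (a ∧ b) ≤ 𝟙 a
          ∧-≤ true  b = 𝟙≤1 b
          ∧-≤ false b = z≤n
          shuffle : ∀ a b c → a + b + c ≡ a + c + b
          shuffle = solve-∀

      distribute : ∀ n κ r .{{_ : NonZero r}} → Balanced κ r → ∣ cell κ r ∣ ≡ n →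
                   ∃ λ κ′ → Balanced κ′ r × ∣ cell κ′ r ∣ ≡ 0
      distribute zero    κ r inv eq = κ , inv , eq
      distribute (suc n) κ r inv eq
        with nonempty {S = cell κ r} (subst (0 <_) (sym eq) z<s) | argmin (λ q → ∣ cell κ q ∣) r
      ... | x , x∈ | p , p<r , smallest with insert inv x (≡ᵇ-true x∈) p p<r smallest
      ...   | κ′ , inv′ , drop = distribute n κ′ r inv′ (suc-injective (trans (sym drop) eq))

    -- Blocks have size m = bu and at most 2u exceptions.  The remainder has fewer than N / 2b elements
    -- and adds at most u + 1 ≤ 2u of them to each block, so a part has at most 4u ≤ m / 4e exceptions.
    regular-partition : ∀ e b .{{_ : NonZero b}} u .{{_ : NonZero u}} d (h : C → ℕ) →
      4 * e * 4 ≡ b → length tests ≤ 2 ^ u → ∑ cs h ≤ d → (¬ ∃ λ c → Shatter c (suc (h c)) full) →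
      2 * b * ((4 * b) ^ d * (2 * (b * u))) ≤ N →
      ∃ λ r → Σ (Fin N → Fin r) λ part → IsPartition part × IsEquitable part ×
        (∀ p → Good (4 * e) (class part p)) × r * (b * u) ≤ N
    regular-partition e b u d h 16e≡b few ∑h≤d unshattered N-large = build
      (strip m (2 * u) w m>0 pull N (λ _ → 0) 0 start (∣∣≤N _))
      where
      m = b * u
      w = 2 * b
      a = 4 * b
      instance
        w≢0 : NonZero w
        w≢0 = m*n≢0 2 b
        a≢0 : NonZero a
        a≢0 = m*n≢0 4 b
        m≢0 : NonZero m
        m≢0 = m*n≢0 b u
        aᵈ≢0 : NonZero (a ^ d)
        aᵈ≢0 = m^n≢0 a d
      m>0 : 0 < m
      m>0 = >-nonZero⁻¹ m

      start : Stripped m (2 * u) (λ _ → 0) 0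
      start = record { bounded = λ _ → z≤n ; size = λ _ () ; sparse = λ _ () ; total = ∣full∣ }

      pull : ∀ S → N ≤ w * ∣ S ∣ → ∃ λ B → B ⊑ S × ∣ B ∣ ≡ m × Sparse (2 * u) B
      pull S N≤wS = [ fromGood , (λ (c , tree) → ⊥-elim (unshattered (c , Shatter-mono (λ _ → refl) tree))) ]′
        (good-subset a d h S ∑h≤d (≤-trans (>-nonZero⁻¹ (a ^ d * (2 * m)) {{m*n≢0 (a ^ d) (2 * m) {{aᵈ≢0}} {{m*n≢0 2 m}}}}) large-S))
        where
        -- A remainder of at least N/2b elements can afford the factor (4b)^d lost on the way to a
        -- good subset and still leave the 2m elements that sampling needs.
        large-S : a ^ d * (2 * m) ≤ ∣ S ∣
        large-S = *-cancelˡ-≤ w (≤-trans N-large N≤wS)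
        large-T : ∀ T → ∣ S ∣ ≤ a ^ d * ∣ T ∣ → 2 * m ≤ ∣ T ∣
        large-T T S≤ = *-cancelˡ-≤ {2 * m} {∣ T ∣} (a ^ d) {{aᵈ≢0}} (≤-trans large-S S≤)
        fromGood : (∃ λ T → T ⊑ S × Good a T × ∣ S ∣ ≤ a ^ d * ∣ T ∣) →
                   ∃ λ B → B ⊑ S × ∣ B ∣ ≡ m × Sparse (2 * u) B
        fromGood (T , T⊑S , good , S≤) =
          let B , B⊑T , ∣B∣≡m , sparse = sparse-block b u T few (large-T T S≤) good
          in B , (λ eq → T⊑S (B⊑T eq)) , ∣B∣≡m , sparse

      build : (∃ λ κ → ∃ λ r → Stripped m (2 * u) κ r × w * ∣ cell κ r ∣ < N) → _
      -- Without any block the remainder would be everything, contradicting that it is a small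
      -- fraction of N.
      build (κ , zero , stripped , lt) =
        ⊥-elim (<⇒≱ lt (≤-trans (≤-reflexive (sym (Stripped.total stripped))) (m≤n*m _ w)))
      build (κ , r@(suc _) , stripped , lt)
        with distribute m (2 * u) _ κ r (Stripped⇒Balanced m (2 * u) stripped) refl
      ... | κ′ , balanced , empty = r , part , isPartition , isEquitable , good , rm≤N
        where
        open ≤-Reasoning
        module B = Balanced balanced
        R = ∣ cell κ r ∣
        κ′<r : ∀ x → κ′ x < r
        κ′<r x = ≤∧≢⇒< (B.bounded x) λ eq →
          n≮0 (subst (0 <_) empty (∈⇒0<∣∣ {S = cell κ′ r} (≡⇒≡ᵇ-true eq)))
        part : Fin N → Fin r
        part x = fromℕ< (κ′<r x)
        class≗cell : ∀ p x → class part p x ≡ cell κ′ (toℕ p) x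
        class≗cell p x = does-⇔ (mk⇔ (λ eq → trans (sym (toℕ-fromℕ< (κ′<r x))) (cong toℕ eq))
          (λ eq → toℕ-injective (trans (toℕ-fromℕ< (κ′<r x)) eq))) (part x ≟ᶠ p) (κ′ x ≟ toℕ p)
        ∣class∣ : ∀ p → ∣ class part p ∣ ≡ ∣ cell κ′ (toℕ p) ∣
        ∣class∣ p = ∣∣-cong {S = class part p} {T = cell κ′ (toℕ p)} (class≗cell p)
        size-large : ∀ p → m ≤ ∣ class part p ∣
        size-large p = ≤-trans (B.large (toℕ p) (toℕ<n p)) (≤-reflexive (sym (∣class∣ p)))
        equitable : ∀ p q → ∣ class part p ∣ ≤ suc ∣ class part q ∣
        equitable p q = subst₂ (λ i j → i ≤ suc j) (sym (∣class∣ p)) (sym (∣class∣ q))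
          (B.equitable (toℕ p) (toℕ q) (toℕ<n p) (toℕ<n q))
        isPartition : IsPartition part
        isPartition p with nonempty {S = class part p} (≤-trans m>0 (size-large p))
        ... | x , x∈ = x , does⇒≡ (part x ≟ᶠ p) x∈
          where
          does⇒≡ : ∀ {a b : Fin r} (d : Dec (a ≡ b)) → does d ≡ true → a ≡ b
          does⇒≡ (yes p) _ = p
        isEquitable : IsEquitable part
        isEquitable p q = subst₂ (λ i j → i ≤ suc j)
          (sym (partSize≡∣class∣ part p)) (sym (partSize≡∣class∣ part q)) (equitable p q)
        rm≤N : r * m ≤ N
        rm≤N = ≤-trans (m≤m+n (r * m) R) (≤-reflexive (Stripped.total stripped))
        -- From 2bR < N = rm + R ≤ b(ru) + bR, one copy of bR cancels.
        R≤ru : R ≤ r * u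
        R≤ru = *-cancelˡ-≤ b (+-cancelʳ-≤ (b * R) (b * R) (b * (r * u)) (begin
          b * R + b * R               ≡⟨ double b R ⟩
          w * R                       ≤⟨ <⇒≤ lt ⟩
          N                           ≡⟨ Stripped.total stripped ⟨
          r * m + R                   ≤⟨ +-monoʳ-≤ (r * m) (m≤n*m R b) ⟩
          r * m + b * R               ≡⟨ cong (_+ b * R) (shuffle r b u) ⟩
          b * (r * u) + b * R         ∎))
          where
          double : ∀ b R → b * R + b * R ≡ 2 * b * R
          double = solve-∀
          shuffle : ∀ r b u → r * (b * u) ≡ b * (r * u)
          shuffle = solve-∀
        -- By equitability a part exceeds the mean by at most 1. The mean is m + R/r ≤ m + u, and 1
        -- + u ≤ 2u.
        size-small : ∀ p → ∣ class part p ∣ ≤ m + 2 * u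
        size-small p = ≤-trans (*-cancelˡ-≤ r (begin
          r * s                                          ≡⟨ trans (∑-const (allFin r) s) (cong (_* s) (length-allFin r)) ⟨
          ∑ (allFin r) (λ _ → s)                         ≤⟨ ∑-mono (allFin r) (equitable p) ⟩
          ∑ (allFin r) (λ q → 1 + ∣ class part q ∣)      ≡⟨ ∑-+ (allFin r) (λ _ → 1) _ ⟩
          ∑ (allFin r) (λ _ → 1) + ∑ (allFin r) (λ q → ∣ class part q ∣)  ≡⟨ cong₂ _+_ (trans (∑-one (allFin r)) (length-allFin r)) (∑∣class∣ part) ⟩
          r + N                                          ≡⟨ cong (r +_) (Stripped.total stripped) ⟨
          r + (r * m + R)                                ≤⟨ +-monoʳ-≤ r (+-monoʳ-≤ (r * m) R≤ru) ⟩
          r + (r * m + r * u)                            ≡⟨ collect r m u ⟩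
          r * (m + (1 + u))                              ∎))
          (+-monoʳ-≤ m (≤-trans (+-monoˡ-≤ u (>-nonZero⁻¹ u)) (≤-reflexive (cong (u +_) (sym (+-identityʳ u))))))
          where
          s = ∣ class part p ∣
          collect : ∀ r m u → r + (r * m + r * u) ≡ r * (m + (1 + u))
          collect = solve-∀
        good : ∀ p → Good (4 * e) (class part p)
        good p c t with B.sparse (toℕ p) (toℕ<n p) c t
        ... | σ , le = σ , (begin
          4 * e * ∣ class part p ∩ T ∣     ≤⟨ *-monoʳ-≤ (4 * e) few-exceptions ⟩
          4 * e * (2 * u + 2 * u)          ≡⟨ trans (collect (4 * e) u) (cong (_* u) 16e≡b) ⟩
          m                                ≤⟨ size-large p ⟩
          ∣ class part p ∣                 ∎)
          where
          T = side σ (φ c t)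
          collect : ∀ k u → k * (2 * u + 2 * u) ≡ k * 4 * u
          collect = solve-∀
          few-exceptions : ∣ class part p ∩ T ∣ ≤ 2 * u + 2 * u
          few-exceptions = +-cancelʳ-≤ m _ _ (begin
            ∣ class part p ∩ T ∣ + m          ≡⟨ cong (_+ m) (∣∩∣-cong {S = class part p} {S′ = cell κ′ (toℕ p)} T (class≗cell p)) ⟩
            ∣ cell κ′ (toℕ p) ∩ T ∣ + m       ≤⟨ le ⟩
            2 * u + ∣ cell κ′ (toℕ p) ∣       ≡⟨ cong (2 * u +_) (∣class∣ p) ⟨
            2 * u + ∣ class part p ∣          ≤⟨ +-monoʳ-≤ (2 * u) (size-small p) ⟩
            2 * u + (m + 2 * u)               ≡⟨ shuffle (2 * u) m ⟩
            2 * u + 2 * u + m                 ∎)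
            where
            shuffle : ∀ a m → a + (m + a) ≡ a + a + m
            shuffle = solve-∀

  -- Growth rates

  n<2^n : ∀ n → n < 2 ^ n
  n<2^n zero    = z<s
  n<2^n (suc n) = +-mono-≤ (m^n>0 2 n) (≤-trans (n<2^n n) (≤-reflexive (sym (+-identityʳ (2 ^ n)))))

  -- Halving: with v = ⌊u/2⌋ ≥ 1 one has u ≤ 3v, so C u^(q+1) ≤ (C 3^(q+1) v^q) v. Induction bounds
  -- the first factor by 2^v, and v < 2^v bounds the second.
  polynomial≤exponential : ∀ q C → ∃ λ k → ∀ u → k ≤ u → C * u ^ q ≤ 2 ^ u
  polynomial≤exponential zero C = C , λ u C≤u → ≤-trans (≤-reflexive (*-identityʳ C)) (≤-trans C≤u (<⇒≤ (n<2^n u)))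
  polynomial≤exponential (suc q) C with polynomial≤exponential q (C * 3 ^ suc q)
  ... | k , IH = 2 * suc k , bound
    where
    open ≤-Reasoning
    bound : ∀ u → 2 * suc k ≤ u → C * u ^ suc q ≤ 2 ^ u
    bound u large = begin
      C * u ^ suc q                         ≤⟨ *-monoʳ-≤ C (^-monoˡ-≤ (suc q) u≤3v) ⟩
      C * (3 * v) ^ suc q                   ≡⟨ cong (C *_) (^-distribʳ-* (suc q) 3 v) ⟩
      C * (3 ^ suc q * (v * v ^ q))         ≡⟨ shuffle C (3 ^ suc q) v (v ^ q) ⟩
      C * 3 ^ suc q * v ^ q * v             ≤⟨ *-mono-≤ (IH v (<⇒≤ k<v)) (<⇒≤ (n<2^n v)) ⟩
      2 ^ v * 2 ^ v                         ≡⟨ ^-distribˡ-+-* 2 v v ⟨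
      2 ^ (v + v)                           ≤⟨ ^-monoʳ-≤ 2 (≤-trans (+-monoʳ-≤ v (⌊n/2⌋≤⌈n/2⌉ u)) (≤-reflexive (⌊n/2⌋+⌈n/2⌉≡n u))) ⟩
      2 ^ u                                 ∎
      where
      v = ⌊ u /2⌋
      shuffle : ∀ a b c d → a * (b * (c * d)) ≡ a * b * d * c
      shuffle = solve-∀
      k<v : k < v
      k<v = ≤-trans (≤-reflexive (trans (n≡⌊n+n/2⌋ (suc k)) (cong (λ n → ⌊ suc k + n /2⌋) (sym (+-identityʳ (suc k))))))
                    (⌊n/2⌋-mono large)
      ⌈⌉≤ : ∀ n → ⌈ n /2⌉ ≤ suc ⌊ n /2⌋
      ⌈⌉≤ zero          = z≤n
      ⌈⌉≤ (suc zero)    = ≤-refl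
      ⌈⌉≤ (suc (suc n)) = s≤s (⌈⌉≤ n)
      u≤3v : u ≤ 3 * v
      u≤3v = begin
        u                     ≡⟨ ⌊n/2⌋+⌈n/2⌉≡n u ⟨
        v + ⌈ u /2⌉           ≤⟨ +-monoʳ-≤ v (⌈⌉≤ u) ⟩
        v + (1 + v)           ≤⟨ +-monoʳ-≤ v (+-monoˡ-≤ v (≤-trans (s≤s z≤n) k<v)) ⟩
        v + (v + v)           ≡⟨ cong (λ n → v + (v + n)) (+-identityʳ v) ⟨
        3 * v                 ∎

  -- Colours and lines of a structure

  module _ (L : Lang) where

    Colour : Set
    Colour = Σ (Fin (size L)) (Fin ∘ arity L)

    _≟ᶜ_ : DecidableEquality Colour
    _≟ᶜ_ = Σ-≡-dec _≟ᶠ_ _≟ᶠ_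

    positions : Fin (size L) → List Colour
    positions E = map (E ,_) (allFin (arity L E))

    colours : List Colour
    colours = concatMap positions (allFin (size L))

    ∈colours : ∀ c → c ∈ colours
    ∈colours (E , j) = ∈-concatMap⁺ _ (Any.map (λ { refl → ∈-map⁺ (E ,_) (∈-allFin j) }) (∈-allFin E))

    arity≤qL : ∀ E → arity L E ≤ qL L
    arity≤qL E = ∈⇒≤max (allFin (size L)) (∈-allFin E)
      where
      ∈⇒≤max : ∀ xs → E ∈ xs → arity L E ≤ foldr _⊔_ 0 (map (arity L) xs)
      ∈⇒≤max (x ∷ xs) (here refl) = m≤m⊔n (arity L E) _
      ∈⇒≤max (x ∷ xs) (there E∈)  = ≤-trans (∈⇒≤max xs E∈) (m≤n⊔m (arity L x) _)

    length-colours : length colours ≤ nL L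
    length-colours = begin
      length colours
        ≡⟨ trans (sym (∑-one colours)) (∑-concatMap positions (allFin (size L)) (λ _ → 1)) ⟩
      ∑ (allFin (size L)) (λ E → ∑ (positions E) (λ _ → 1))
        ≡⟨ ∑-cong (allFin (size L)) (λ E → trans (∑-map {B = Colour} (E ,_) (allFin (arity L E)) (λ _ → 1))
             (trans (∑-one (allFin (arity L E))) (length-allFin (arity L E)))) ⟩
      ∑ (allFin (size L)) (arity L)
        ≤⟨ ∑-mono (allFin (size L)) arity≤qL ⟩
      ∑ (allFin (size L)) (λ _ → qL L)
        ≡⟨ trans (∑-const (allFin (size L)) (qL L)) (cong (_* qL L) (length-allFin (size L))) ⟩
      nL L ∎
      where open ≤-Reasoning

    module _ {N : ℕ} where

      Parameter : Colour → Set
      Parameter (E , j) = Vec (Fin N) (pred (arity L E))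

      parameters : ∀ c → List (Parameter c)
      parameters (E , j) = allVecs N (pred (arity L E))

      ∈parameters : ∀ c (b : Parameter c) → b ∈ parameters c
      ∈parameters (E , j) b = ∈-allVecs b

      lines : Structure L N → ∀ c → Parameter c → Sub N
      lines 𝓜 (E , j) b = line (𝓜 E) j b

  module Lines {L : Lang} {N : ℕ} (𝓜 : Structure L N) where

    open Tests (_≟ᶜ_ L) (colours L) (∈colours L) (parameters L) (∈parameters L) (lines L 𝓜) public
    open Regularity (_≟ᶜ_ L) (colours L) (∈colours L) (parameters L) (∈parameters L) (lines L 𝓜) public

    branching : ∀ {n τ} (R : Vec (Fin N) n → Bool) j →
      (Σ (Vec Bool τ → Fin N) λ a → Σ (List Bool → Vec (Fin N) (pred n)) λ b →
        (∀ i (d : Fin τ) → line R j (b (take (toℕ d) (toList i))) (a i) ≡ lookup i d)) →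
      HasBranchingAt τ n R j
    branching {suc n} R j (a , b , agrees) = a , b , λ i d →
      mk⇔ (trans (sym (agrees i d))) (trans (agrees i d))

    unshattered : ∀ {τ} → NonBranching τ 𝓜 → ∀ c → ¬ Shatter c τ full
    unshattered nb (E , j) tree =
      let a , b , _ , agrees = Shatter⇒branching (λ x → Vec.replicate _ x) tree
      in nb E j (branching (𝓜 E) j (a , b , agrees))

    -- Lets depth be counted in `pred τ` for every τ. At τ = 0 a tree of height 1 still contains a
    -- point, which is a tree of height 0.
    unshattered-pred : ∀ {τ} → NonBranching τ 𝓜 → ∀ c → ¬ Shatter c (suc (pred τ)) full
    unshattered-pred {suc τ} nb c tree = unshattered nb c tree
    unshattered-pred {zero}  nb c (node b t) with t true
    ... | leaf x _ = unshattered nb c (leaf x refl)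

    length-tests≤ : .{{_ : NonZero N}} → length tests ≤ nL L * N ^ qL L
    length-tests≤ = begin
      length tests                                        ≡⟨ length-tests ⟩
      ∑ (colours L) (length ∘ parameters L)               ≤⟨ ∑-mono (colours L) few ⟩
      ∑ (colours L) (λ _ → N ^ qL L)                      ≡⟨ ∑-const (colours L) (N ^ qL L) ⟩
      length (colours L) * N ^ qL L                       ≤⟨ *-monoˡ-≤ (N ^ qL L) (length-colours L) ⟩
      nL L * N ^ qL L                                     ∎
      where
      open ≤-Reasoning
      few : ∀ c → length (parameters L c) ≤ N ^ qL L
      few (E , j) = ≤-trans (≤-reflexive (length-allVecs N (pred (arity L E))))
                            (^-monoʳ-≤ N (≤-trans pred[n]≤n (arity≤qL L E)))

    -- The majority structure and its distance from the given one.

    module Majority {r : ℕ} (part : Fin N → Fin r) where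

      parts : ∀ {k} → Vec (Fin r) k → Vec (Sub N) k
      parts = Vec.map (class part)

      positive negative : ∀ E → Vec (Fin r) (arity L E) → ℕ
      positive E ps = box (parts ps) (𝟙 ∘ 𝓜 E)
      negative E ps = box (parts ps) (𝟙 ∘ not ∘ 𝓜 E)

      majority : ∀ E → Vec (Fin r) (arity L E) → Bool
      majority E ps = negative E ps ≤ᵇ positive E ps

      𝓝 : Structure L N
      𝓝 E t = majority E (Vec.map part t)

      indivisible : IsIndivisible part 𝓝
      indivisible E a₀ a₁ eq = cong (majority E) (map-ext a₀ a₁ eq)
        where
        map-ext : ∀ {k} (s t : Vec (Fin N) k) → (∀ i → part (lookup s i) ≡ part (lookup t i)) →
                  Vec.map part s ≡ Vec.map part t
        map-ext []      []      eq = refl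
        map-ext (x ∷ s) (y ∷ t) eq = cong₂ _∷_ (eq zero) (map-ext s t (eq ∘ suc))

      boxSize≡volume : ∀ {k} (ps : Vec (Fin r) k) → boxSize part ps ≡ volume (parts ps)
      boxSize≡volume []       = refl
      boxSize≡volume (p ∷ ps) = trans (cong₂ _*_ (partSize≡∣class∣ part p) (boxSize≡volume ps))
                                      (sym (volume-∷ (class part p) (parts ps)))

      weight-∈ : ∀ {k} (t : Vec (Fin N) k) → weight (parts (Vec.map part t)) t ≡ 1
      weight-∈ []      = refl
      weight-∈ (x ∷ t) with part x ≟ᶠ part x
      ... | yes _   = trans (+-identityʳ _) (weight-∈ t)
      ... | no  p≢p = ⊥-elim (p≢p refl)

      weight-∉ : ∀ {k} (t : Vec (Fin N) k) ps → Vec.map part t ≢ ps → weight (parts ps) t ≡ 0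
      weight-∉ []      []       ≢ = ⊥-elim (≢ refl)
      weight-∉ (x ∷ t) (p ∷ ps) ≢ with part x ≟ᶠ p
      ... | yes refl = trans (+-identityʳ _) (weight-∉ t ps (λ eq → ≢ (cong (part x ∷_) eq)))
      ... | no  _    = refl

      -- The weight singles out the tuples lying over `ps`, and on these `𝓝` takes the constant
      -- value `majority E ps`.
      symDiff≡box : ∀ E ps → symDiffCount part 𝓜 𝓝 E ps ≡
                    box (parts ps) (λ t → 𝟙 (does (¬? (𝓜 E t ≟ᵇ majority E ps))))
      symDiff≡box E ps = trans (length-filter≡∑ differ? (allVecs N (arity L E))) (∑-cong (allVecs N (arity L E)) pw)
        where
        differ? : ∀ t → Dec (Vec.map part t ≡ ps × ¬ (𝓜 E t ≡ 𝓝 E t))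
        differ? t = ≡-dec _≟ᶠ_ (Vec.map part t) ps ×-dec ¬? (𝓜 E t ≟ᵇ 𝓝 E t)
        pw : ∀ t → 𝟙 (does (differ? t)) ≡ weight (parts ps) t * 𝟙 (does (¬? (𝓜 E t ≟ᵇ majority E ps)))
        pw t with ≡-dec _≟ᶠ_ (Vec.map part t) ps
        ... | yes refl rewrite weight-∈ t       = sym (+-identityʳ _)
        ... | no  t∉   rewrite weight-∉ t ps t∉ = refl

      -- On a good part one side of each line has at most ∣S∣/4e elements and the other at most ∣S∣,
      -- so their product meets the hypothesis of the variance bound; the tuples on which `𝓝` errs
      -- are the minority.
      symDiff-bound : ∀ e → (∀ p → Good (4 * e) (class part p)) → ∀ E ps →
        2 * e * symDiffCount part 𝓜 𝓝 E ps ≤ arity L E * boxSize part ps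
      symDiff-bound e good E ps = subst₂ (λ s v → 2 * e * s ≤ arity L E * v)
        (sym (symDiff≡box E ps)) (sym (boxSize≡volume ps)) (minority (majority E ps) refl)
        where
        thin : ∀ j b → 4 * e * (∣ lookup (parts ps) j ∩ line (𝓜 E) j b ∣ *
                                ∣ lookup (parts ps) j ∩ (not ∘ line (𝓜 E) j b) ∣)
                     ≤ ∣ lookup (parts ps) j ∣ * ∣ lookup (parts ps) j ∣
        thin j b rewrite lookup-map j (class part) ps with good (lookup ps j) (E , j) b
        ... | true , le = ≤-trans (≤-reflexive (sym (*-assoc (4 * e) _ _)))
                (*-mono-≤ le (∣∣-mono {S = S ∩ (not ∘ ψ)} {T = S} (∩-⊑ˡ {S = S} {T = not ∘ ψ})))
          where
          S = class part (lookup ps j)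
          ψ = line (𝓜 E) j b
        ... | false , le = ≤-trans (≤-reflexive (flip (4 * e) ∣ S ∩ ψ ∣ _))
                (*-mono-≤ (∣∣-mono {S = S ∩ ψ} {T = S} (∩-⊑ˡ {S = S} {T = ψ})) le)
          where
          S = class part (lookup ps j)
          ψ = line (𝓜 E) j b
          flip : ∀ a b c → a * (b * c) ≡ b * (a * c)
          flip = solve-∀
        not-≡ : ∀ a → does (¬? (a ≟ᵇ true)) ≡ not a
        not-≡ true  = refl
        not-≡ false = refl
        not-≢ : ∀ a → does (¬? (a ≟ᵇ false)) ≡ a
        not-≢ true  = refl
        not-≢ false = refl
        minority : ∀ m → majority E ps ≡ m →
                   2 * e * box (parts ps) (λ t → 𝟙 (does (¬? (𝓜 E t ≟ᵇ m)))) ≤ arity L E * volume (parts ps)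
        minority true maj = ≤-trans (≤-reflexive (cong (2 * e *_) (box-cong (parts ps) (λ t → cong 𝟙 (not-≡ (𝓜 E t))))))
          (box-minority (parts ps) (𝓜 E) e thin {positive E ps} {negative E ps} refl
            (box-complement (parts ps) (𝓜 E)) (≤ᵇ⇒≤ _ _ (subst Bool.T (sym maj) tt)))
        minority false maj = ≤-trans (≤-reflexive (cong (2 * e *_) (box-cong (parts ps) (λ t → cong 𝟙 (not-≢ (𝓜 E t))))))
          (box-minority (parts ps) (𝓜 E) e thin {negative E ps} {positive E ps}
            (*-comm (negative E ps) (positive E ps))
            (trans (+-comm (negative E ps) _) (box-complement (parts ps) (𝓜 E)))
            (<⇒≤ (≰⇒> λ le → subst Bool.T maj (≤⇒≤ᵇ le))))

  -- The parameter u and the number of parts.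

  -- `u` is the quotient of N by Q. The lower bound on N makes room for the partition, the upper one
  -- limits the number of parts, and the last inequality lets 2^u exceed the number of tests.
  -- Starting at Q(k + 1) ensures u > k.
  threshold : ∀ n q Q .{{_ : NonZero Q}} → ∃ λ k → ∀ N → k ≤ N →
    ∃ λ u → NonZero u × Q * u ≤ N × N ≤ Q * (2 * u) × n * N ^ q ≤ 2 ^ u
  threshold n q Q with polynomial≤exponential q (n * (Q * 2) ^ q)
  ... | k , dominated = Q * suc k , enough
    where
    open ≤-Reasoning
    enough : ∀ N → Q * suc k ≤ N → _
    enough N large = u , >-nonZero u>0 , Qu≤N , N≤2Qu , (begin
      n * N ^ q                          ≤⟨ *-monoʳ-≤ n (^-monoˡ-≤ q N≤2Qu) ⟩
      n * (Q * (2 * u)) ^ q            ≡⟨ cong (λ x → n * x ^ q) (*-assoc Q 2 u) ⟨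
      n * (Q * 2 * u) ^ q              ≡⟨ cong (n *_) (^-distribʳ-* q (Q * 2) u) ⟩
      n * ((Q * 2) ^ q * u ^ q)       ≡⟨ *-assoc n _ _ ⟨
      n * (Q * 2) ^ q * u ^ q         ≤⟨ dominated u (<⇒≤ k<u) ⟩
      2 ^ u                               ∎)
      where
      u = N / Q
      k<u : k < u
      k<u = ≤-trans (≤-reflexive (sym (trans (cong (_/ Q) (*-comm Q (suc k))) (m*n/n≡m (suc k) Q)))) (/-monoˡ-≤ Q large)
      u>0 : 0 < u
      u>0 = ≤-trans z<s k<u
      Qu≤N : Q * u ≤ N
      Qu≤N = ≤-trans (≤-reflexive (*-comm Q u)) (m/n*n≤m N Q)
      N≤2Qu : N ≤ Q * (2 * u)
      N≤2Qu = begin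
        N                            ≡⟨ m≡m%n+[m/n]*n N Q ⟩
        N % Q + u * Q   ≤⟨ +-monoˡ-≤ (u * Q) (<⇒≤ (m%n<n N Q)) ⟩
        Q + u * Q                  ≤⟨ +-monoˡ-≤ (u * Q) (m≤m*n Q u {{>-nonZero u>0}}) ⟩
        Q * u + u * Q             ≡⟨ collect Q u ⟩
        Q * (2 * u)                ∎
        where
        collect : ∀ Q u → Q * u + u * Q ≡ Q * (2 * u)
        collect = solve-∀

  -- Cancelling the block size `b * u` leaves r ≤ 8b(4b)^d. Each of these d + 1 factors is at most
  -- 8b = 128e ≤ e².
  part-count : ∀ e b d {r u N} .{{_ : NonZero b}} .{{_ : NonZero u}} → 4 * e * 4 ≡ b → 128 ≤ e →
    r * (b * u) ≤ N → N ≤ 2 * b * ((4 * b) ^ d * (2 * b)) * (2 * u) → r ≤ e ^ (2 * suc d)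
  part-count e b d {r} {u} {N} 16e≡b 128≤e rm≤N N≤ = begin
    r                                   ≤⟨ *-cancelʳ-≤ r (8 * b * X) (b * u) {{m*n≢0 b u}} (≤-trans rm≤N (≤-trans N≤ (≤-reflexive (shuffle b X u)))) ⟩
    8 * b * X                         ≤⟨ *-mono-≤ 8b≤e² (^-monoˡ-≤ d (≤-trans (*-monoˡ-≤ b {4} {8} (s≤s (s≤s (s≤s (s≤s z≤n))))) 8b≤e²)) ⟩
    e * e * (e * e) ^ d             ≡⟨ cong (λ x → x ^ suc d) (cong (e *_) (sym (*-identityʳ e))) ⟩
    (e ^ 2) ^ suc d                   ≡⟨ ^-*-assoc e 2 (suc d) ⟩
    e ^ (2 * suc d)                   ∎
    where
    open ≤-Reasoning
    X = (4 * b) ^ d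
    shuffle : ∀ b X u → 2 * b * (X * (2 * b)) * (2 * u) ≡ 8 * b * X * (b * u)
    shuffle = solve-∀
    8b≤e² : 8 * b ≤ e * e
    8b≤e² = begin
      8 * b                    ≡⟨ cong (8 *_) 16e≡b ⟨
      8 * (4 * e * 4)        ≡⟨ cong (8 *_) (trans (*-comm (4 * e) 4) (sym (*-assoc 4 4 e))) ⟩
      8 * (16 * e)            ≡⟨ *-assoc 8 16 e ⟨
      128 * e                  ≤⟨ *-monoˡ-≤ e 128≤e ⟩
      e * e                    ∎

  n*0-zero : ∀ n → ¬ NonZero (n * 0)
  n*0-zero n nz = <⇒≢ (>-nonZero⁻¹ (n * 0) {{nz}}) (sym (*-zeroʳ n))

  -- For τ ≥ 2 the logarithm is at least 1, so g is at least 5 n_L τ, which exceeds 2 n_L (τ - 1).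
  2d≤gOf : ∀ L τ → NonZero (nL L * pred τ) → 2 * (nL L * pred τ) ≤ gOf L τ
  2d≤gOf L zero       nz = ⊥-elim (n*0-zero (nL L) nz)
  2d≤gOf L (suc zero) nz = ⊥-elim (n*0-zero (nL L) nz)
  2d≤gOf L τ@(suc (suc τ-2)) nz = begin
    2 * (nL L * pred τ)                       ≡⟨ *-assoc 2 (nL L) (pred τ) ⟨
    2 * nL L * pred τ                         ≤⟨ *-mono-≤ (*-monoˡ-≤ (nL L) {2} {5} (s≤s (s≤s z≤n))) (n≤1+n (pred τ)) ⟩
    5 * nL L * τ                              ≡⟨ ⌈log₂2^n⌉≡n _ ⟨
    ⌈log₂ 2 ^ (5 * nL L * τ) ⌉               ≤⟨ ⌈log₂⌉-mono-≤ (^-monoˡ-≤ (5 * nL L * τ) {2} {τ} (s≤s (s≤s z≤n))) ⟩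
    gOf L τ                                     ∎
    where open ≤-Reasoning

-- Passage between the rational ε and the natural number e.

module RationalEstimates where

  open import Defs using (ℕ→ℚ; _^ℚ_)
  open import Data.Integer.Base as ℤ using (+_; +[1+_]; +≤+; +<+)
  import Data.Integer.Properties as ℤ
  open import Data.Nat.Base as ℕ using (ℕ; zero; suc)
  open import Data.Nat.DivMod using (m/n*n≤m; m≡m%n+[m/n]*n; m%n<n)
  import Data.Nat.Properties as ℕ
  open import Data.Product.Base using (∃; _×_; _,_)
  open import Data.Rational.Base
  open import Data.Rational.Properties
  import Data.Rational.Unnormalised.Base as ℚᵘ
  import Data.Rational.Unnormalised.Properties as ℚᵘ
  open import Relation.Binary.PropositionalEquality

  -- `+ n / 1` is normalised by a gcd and does not reduce for variable `n`; arithmetic and order are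
  -- therefore transported from unnormalised fractions.
  toℚᵘ-ℕ→ℚ : ∀ n → toℚᵘ (ℕ→ℚ n) ℚᵘ.≃ ℚᵘ.mkℚᵘ (+ n) 0
  toℚᵘ-ℕ→ℚ n = toℚᵘ-fromℚᵘ (ℚᵘ.mkℚᵘ (+ n) 0)

  ℕ→ℚ-* : ∀ m n → ℕ→ℚ (m ℕ.* n) ≡ ℕ→ℚ m * ℕ→ℚ n
  ℕ→ℚ-* m n = toℚᵘ-injective (begin-equality
    toℚᵘ (ℕ→ℚ (m ℕ.* n))                          ≃⟨ toℚᵘ-ℕ→ℚ (m ℕ.* n) ⟩
    ℚᵘ.mkℚᵘ (+ (m ℕ.* n)) 0                       ≃⟨ ℚᵘ.*≡* (cong (ℤ._* + 1) (ℤ.pos-* m n)) ⟩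
    ℚᵘ.mkℚᵘ (+ m) 0 ℚᵘ.* ℚᵘ.mkℚᵘ (+ n) 0          ≃⟨ ℚᵘ.*-cong (toℚᵘ-ℕ→ℚ m) (toℚᵘ-ℕ→ℚ n) ⟨
    toℚᵘ (ℕ→ℚ m) ℚᵘ.* toℚᵘ (ℕ→ℚ n)                ≃⟨ toℚᵘ-homo-* (ℕ→ℚ m) (ℕ→ℚ n) ⟨
    toℚᵘ (ℕ→ℚ m * ℕ→ℚ n)                          ∎)
    where open ℚᵘ.≤-Reasoning

  ℕ→ℚ-mono-≤ : ∀ {m n} → m ℕ.≤ n → ℕ→ℚ m ≤ ℕ→ℚ n
  ℕ→ℚ-mono-≤ {m} {n} m≤n = toℚᵘ-cancel-≤ (begin
    toℚᵘ (ℕ→ℚ m)       ≃⟨ toℚᵘ-ℕ→ℚ m ⟩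
    ℚᵘ.mkℚᵘ (+ m) 0    ≤⟨ ℚᵘ.*≤* (ℤ.*-monoʳ-≤-nonNeg (+ 1) (+≤+ m≤n)) ⟩
    ℚᵘ.mkℚᵘ (+ n) 0    ≃⟨ toℚᵘ-ℕ→ℚ n ⟨
    toℚᵘ (ℕ→ℚ n)       ∎)
    where open ℚᵘ.≤-Reasoning

  ℕ→ℚ-mono-< : ∀ {m n} → m ℕ.< n → ℕ→ℚ m < ℕ→ℚ n
  ℕ→ℚ-mono-< {m} {n} m<n = toℚᵘ-cancel-< (begin-strict
    toℚᵘ (ℕ→ℚ m)       ≃⟨ toℚᵘ-ℕ→ℚ m ⟩
    ℚᵘ.mkℚᵘ (+ m) 0    <⟨ ℚᵘ.*<* (ℤ.*-monoʳ-<-pos (+ 1) (+<+ m<n)) ⟩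
    ℚᵘ.mkℚᵘ (+ n) 0    ≃⟨ toℚᵘ-ℕ→ℚ n ⟨
    toℚᵘ (ℕ→ℚ n)       ∎)
    where open ℚᵘ.≤-Reasoning

  ℕ→ℚ-nonNeg : ∀ n → NonNegative (ℕ→ℚ n)
  ℕ→ℚ-nonNeg n = nonNegative (ℕ→ℚ-mono-≤ {0} {n} ℕ.z≤n)

  ℕ→ℚ-pos : ∀ n → Positive (ℕ→ℚ (suc n))
  ℕ→ℚ-pos n = positive (ℕ→ℚ-mono-< {0} {suc n} ℕ.z<s)

  ℚ-fraction : ∀ ε {p} → ↥ ε ≡ + p → ε * ℕ→ℚ (↧ₙ ε) ≡ ℕ→ℚ p
  ℚ-fraction ε@(mkℚ (+ p) q-1 _) refl = toℚᵘ-injective (begin-equality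
    toℚᵘ (ε * ℕ→ℚ q)                              ≃⟨ toℚᵘ-homo-* ε (ℕ→ℚ q) ⟩
    ℚᵘ.mkℚᵘ (+ p) q-1 ℚᵘ.* toℚᵘ (ℕ→ℚ q)           ≃⟨ ℚᵘ.*-congˡ {ℚᵘ.mkℚᵘ (+ p) q-1} (toℚᵘ-ℕ→ℚ q) ⟩
    ℚᵘ.mkℚᵘ (+ p) q-1 ℚᵘ.* ℚᵘ.mkℚᵘ (+ q) 0        ≃⟨ ℚᵘ.*≡* cross ⟩
    ℚᵘ.mkℚᵘ (+ p) 0                               ≃⟨ toℚᵘ-ℕ→ℚ p ⟨
    toℚᵘ (ℕ→ℚ p)                                  ∎)
    where
    open ℚᵘ.≤-Reasoning
    q = suc q-1
    cross : (+ p ℤ.* + q) ℤ.* + 1 ≡ + p ℤ.* + (q ℕ.* 1)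
    cross = trans (ℤ.*-identityʳ _) (cong (λ n → + p ℤ.* + n) (sym (ℕ.*-identityʳ q)))

  -- For ε = p/q the witness is the integer quotient of q by p; multiplied by q, both bounds are
  -- division with remainder.
  reciprocal-floor : ∀ ε → 0ℚ < ε → ∃ λ e → ℕ→ℚ e * ε ≤ 1ℚ × 1ℚ < ℕ→ℚ (suc e) * ε
  reciprocal-floor (mkℚ (+ zero)   q-1 isC) 0<ε with () ← positive 0<ε
  reciprocal-floor (mkℚ ℤ.-[1+ _ ] q-1 isC) 0<ε with () ← positive 0<ε
  reciprocal-floor ε@(mkℚ +[1+ p-1 ] q-1 isC) 0<ε = e ,
    *-cancelʳ-≤-pos (ℕ→ℚ q) {{ℕ→ℚ-pos q-1}} (subst₂ _≤_ (sym (scale e)) (sym (*-identityˡ (ℕ→ℚ q)))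
      (ℕ→ℚ-mono-≤ (m/n*n≤m q p))) ,
    *-cancelʳ-<-nonNeg (ℕ→ℚ q) {{ℕ→ℚ-nonNeg q}} (subst₂ _<_ (sym (*-identityˡ (ℕ→ℚ q))) (sym (scale (suc e)))
      (ℕ→ℚ-mono-< q<[1+e]p))
    where
    p = suc p-1
    q = suc q-1
    e = q ℕ./ p
    scale : ∀ n → ℕ→ℚ n * ε * ℕ→ℚ q ≡ ℕ→ℚ (n ℕ.* p)
    scale n = trans (*-assoc (ℕ→ℚ n) ε (ℕ→ℚ q))
      (trans (cong (ℕ→ℚ n *_) (ℚ-fraction ε refl)) (sym (ℕ→ℚ-* n p)))
    q<[1+e]p : q ℕ.< suc e ℕ.* p
    q<[1+e]p = ℕ.≤-trans (ℕ.s≤s (ℕ.≤-reflexive (m≡m%n+[m/n]*n q p)))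
      (ℕ.+-monoˡ-≤ (e ℕ.* p) (m%n<n q p))

  ^ℚ-nonNeg : ∀ ε .{{_ : NonNegative ε}} n → NonNegative (ε ^ℚ n)
  ^ℚ-nonNeg ε zero    = _
  ^ℚ-nonNeg ε (suc n) = nonNeg*nonNeg⇒nonNeg ε (ε ^ℚ n) {{^ℚ-nonNeg ε n}}

  2^n*½^n≡1 : ∀ n → ℕ→ℚ (2 ℕ.^ n) * (½ ^ℚ n) ≡ 1ℚ
  2^n*½^n≡1 zero    = refl
  2^n*½^n≡1 (suc n) = begin
    ℕ→ℚ (2 ℕ.* 2 ℕ.^ n) * (½ * (½ ^ℚ n))          ≡⟨ cong (_* (½ * (½ ^ℚ n))) (trans (ℕ→ℚ-* 2 (2 ℕ.^ n)) (*-comm (ℕ→ℚ 2) t)) ⟩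
    t * ℕ→ℚ 2 * (½ * (½ ^ℚ n))                    ≡⟨ *-assoc t (ℕ→ℚ 2) _ ⟩
    t * (ℕ→ℚ 2 * (½ * (½ ^ℚ n)))                  ≡⟨ cong (t *_) (sym (*-assoc (ℕ→ℚ 2) ½ (½ ^ℚ n))) ⟩
    t * (1ℚ * (½ ^ℚ n))                           ≡⟨ cong (t *_) (*-identityˡ (½ ^ℚ n)) ⟩
    t * (½ ^ℚ n)                                  ≡⟨ 2^n*½^n≡1 n ⟩
    1ℚ                                            ∎
    where
    open ≡-Reasoning
    t = ℕ→ℚ (2 ℕ.^ n)

  -- If e + 1 ≤ 2^n, then 1 < (e + 1)ε ≤ 2^n ε ≤ 1.
  2^n≤reciprocal : ∀ {ε} e n → 1ℚ < ℕ→ℚ (suc e) * ε → 0ℚ < ε → ε < ½ ^ℚ n → 2 ℕ.^ n ℕ.≤ e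
  2^n≤reciprocal {ε} e n 1< 0<ε ε< = ℕ.≮⇒≥ λ e<2^n → <-irrefl refl (begin-strict
    1ℚ                              <⟨ 1< ⟩
    ℕ→ℚ (suc e) * ε                 ≤⟨ *-monoʳ-≤-nonNeg ε {{pos⇒nonNeg ε {{positive 0<ε}}}} (ℕ→ℚ-mono-≤ e<2^n) ⟩
    ℕ→ℚ (2 ℕ.^ n) * ε               ≤⟨ *-monoˡ-≤-nonNeg (ℕ→ℚ (2 ℕ.^ n)) {{ℕ→ℚ-nonNeg (2 ℕ.^ n)}} (<⇒≤ ε<) ⟩
    ℕ→ℚ (2 ℕ.^ n) * (½ ^ℚ n)        ≡⟨ 2^n*½^n≡1 n ⟩
    1ℚ                              ∎)
    where open ≤-Reasoning

  module _ {ε : ℚ} .{{_ : NonNegative ε}} {e : ℕ} where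
    open ≤-Reasoning

    count-bound : ℕ→ℚ e * ε ≤ 1ℚ → ∀ n {r} → r ℕ.≤ e ℕ.^ n → ℕ→ℚ r * (ε ^ℚ n) ≤ 1ℚ
    count-bound eε≤1 n {r} r≤ = ≤-trans (*-monoʳ-≤-nonNeg (ε ^ℚ n) {{^ℚ-nonNeg ε n}} (ℕ→ℚ-mono-≤ r≤)) (power n)
      where
      power : ∀ n → ℕ→ℚ (e ℕ.^ n) * (ε ^ℚ n) ≤ 1ℚ
      power zero    = ≤-refl
      power (suc n) = begin
        ℕ→ℚ (e ℕ.* e ℕ.^ n) * (ε * (ε ^ℚ n))     ≡⟨ cong (_* (ε * (ε ^ℚ n))) (trans (ℕ→ℚ-* e (e ℕ.^ n)) (*-comm (ℕ→ℚ e) t)) ⟩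
        t * ℕ→ℚ e * (ε * (ε ^ℚ n))               ≡⟨ trans (*-assoc t _ _) (cong (t *_) (sym (*-assoc (ℕ→ℚ e) ε (ε ^ℚ n)))) ⟩
        t * (ℕ→ℚ e * ε * (ε ^ℚ n))               ≤⟨ *-monoˡ-≤-nonNeg t {{ℕ→ℚ-nonNeg (e ℕ.^ n)}} (*-monoʳ-≤-nonNeg (ε ^ℚ n) {{^ℚ-nonNeg ε n}} eε≤1) ⟩
        t * (1ℚ * (ε ^ℚ n))                      ≡⟨ cong (t *_) (*-identityˡ (ε ^ℚ n)) ⟩
        t * (ε ^ℚ n)                             ≤⟨ power n ⟩
        1ℚ                                       ∎
        where t = ℕ→ℚ (e ℕ.^ n)

    -- Since 1 < (e + 1)ε ≤ 2eε, the factor 2 in front of `e` pays for rounding 1/ε down.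
    error-bound : 1ℚ < ℕ→ℚ (suc e) * ε → 1 ℕ.≤ e → ∀ k {S V} → 2 ℕ.* e ℕ.* S ℕ.≤ k ℕ.* V →
                  ℕ→ℚ S ≤ ℕ→ℚ k * ε * ℕ→ℚ V
    error-bound 1< 1≤e k {S} {V} le = begin
      ℕ→ℚ S                               ≡⟨ *-identityˡ (ℕ→ℚ S) ⟨
      1ℚ * ℕ→ℚ S                          ≤⟨ *-monoʳ-≤-nonNeg (ℕ→ℚ S) {{ℕ→ℚ-nonNeg S}} (<⇒≤ 1<) ⟩
      ℕ→ℚ (suc e) * ε * ℕ→ℚ S             ≤⟨ *-monoʳ-≤-nonNeg (ℕ→ℚ S) {{ℕ→ℚ-nonNeg S}} (*-monoʳ-≤-nonNeg ε (ℕ→ℚ-mono-≤ 1+e≤2e)) ⟩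
      ℕ→ℚ (2 ℕ.* e) * ε * ℕ→ℚ S           ≡⟨ gather (2 ℕ.* e) S ⟩
      ε * ℕ→ℚ (2 ℕ.* e ℕ.* S)             ≤⟨ *-monoˡ-≤-nonNeg ε (ℕ→ℚ-mono-≤ le) ⟩
      ε * ℕ→ℚ (k ℕ.* V)                   ≡⟨ gather k V ⟨
      ℕ→ℚ k * ε * ℕ→ℚ V                   ∎
      where
      gather : ∀ m n → ℕ→ℚ m * ε * ℕ→ℚ n ≡ ε * ℕ→ℚ (m ℕ.* n)
      gather m n = trans (cong (_* ℕ→ℚ n) (*-comm (ℕ→ℚ m) ε))
        (trans (*-assoc ε (ℕ→ℚ m) (ℕ→ℚ n)) (cong (ε *_) (sym (ℕ→ℚ-* m n))))
      1+e≤2e : suc e ℕ.≤ 2 ℕ.* e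
      1+e≤2e = ℕ.+-mono-≤ 1≤e (ℕ.≤-reflexive (sym (ℕ.+-identityʳ e)))

open import Defs
open import Data.Nat using (ℕ; suc; _≥_) renaming (_*_ to _*ℕ_; _+_ to _+ℕ_)
open import Data.Fin using (Fin)
open import Data.Vec using (Vec)
open import Data.Rational using (ℚ; 0ℚ; 1ℚ; ½; _<_; _≤_; _*_)
open import Data.Product using (Σ; ∃; _×_)

open import Data.Empty using (⊥-elim)
open import Data.Fin using (zero)
open import Data.List.Base using (length)
open import Data.Nat using (zero; pred; z≤n; s≤s; NonZero; >-nonZero; >-nonZero⁻¹)
  renaming (_^_ to _^ℕ_; _≤_ to _≤ℕ_)
open import Data.Nat.Properties
open import Data.Nat.Tactic.RingSolver using (solve-∀)
open import Data.Product using (_,_; proj₁; proj₂)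
open import Data.Rational using (NonNegative; positive)
open import Data.Rational.Properties using (pos⇒nonNeg)
open import Data.Sum using (inj₁; inj₂)
open import Relation.Binary.PropositionalEquality using (_≡_; refl; sym; trans; subst)
open Combinatorics
open RationalEstimates

-- The choice of kε, for depth zero and for positive depth.

mainTheorem1 : (L : Lang) (τ : ℕ) (ε : ℚ) →
    0ℚ < ε → ε < ½ ^ℚ ((suc (gOf L τ)) *ℕ (suc (suc (gOf L τ)))) →
    ∃ λ (kε : ℕ) →
    (N : ℕ) (𝓜 : Structure L N) → N ≥ kε → NonBranching τ 𝓜 →
    Σ (Structure L N) λ 𝓝 → Σ ℕ λ r → Σ (Fin N → Fin r) λ part →
    IsPartition part × IsEquitable part
    × ((E : Fin (size L)) (ps : Vec (Fin r) (arity L E)) →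
    ℕ→ℚ (symDiffCount part 𝓜 𝓝 E ps)
    ≤ ℕ→ℚ (arity L E) * ε * ℕ→ℚ (boxSize part ps))
    × IsIndivisible part 𝓝
    × (ℕ→ℚ r * (ε ^ℚ (gOf L τ +ℕ 2)) ≤ 1ℚ)
mainTheorem1 L τ ε 0<ε ε<½^ = byDepth (nL L *ℕ pred τ) refl
  where
  g = gOf L τ
  reciprocal = reciprocal-floor ε 0<ε
  e = proj₁ reciprocal
  eε≤1 = proj₁ (proj₂ reciprocal)
  1<[1+e]ε = proj₂ (proj₂ reciprocal)
  instance
    ε≥0 : NonNegative ε
    ε≥0 = pos⇒nonNeg ε {{positive 0<ε}}
  2^≤e : 2 ^ℕ (suc g *ℕ suc (suc g)) ≤ℕ e
  2^≤e = 2^n≤reciprocal e (suc g *ℕ suc (suc g)) 1<[1+e]ε 0<ε ε<½^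
  1≤e : 1 ≤ℕ e
  1≤e = ≤-trans (m^n>0 2 (suc g *ℕ suc (suc g))) 2^≤e

  Conclusion : ∀ {N} → Structure L N → Set
  Conclusion {N} 𝓜 = Σ (Structure L N) λ 𝓝 → Σ ℕ λ r → Σ (Fin N → Fin r) λ part →
    IsPartition part × IsEquitable part
    × ((E : Fin (size L)) (ps : Vec (Fin r) (arity L E)) →
    ℕ→ℚ (symDiffCount part 𝓜 𝓝 E ps)
    ≤ ℕ→ℚ (arity L E) * ε * ℕ→ℚ (boxSize part ps))
    × IsIndivisible part 𝓝
    × (ℕ→ℚ r * (ε ^ℚ (gOf L τ +ℕ 2)) ≤ 1ℚ)

  conclude : ∀ {N r} (𝓜 : Structure L N) (part : Fin N → Fin r) → IsPartition part → IsEquitable part →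
    (∀ p → Lines.Good 𝓜 (4 *ℕ e) (class part p)) → r ≤ℕ e ^ℕ (g +ℕ 2) → Conclusion 𝓜
  conclude {r = r} 𝓜 part isPartition isEquitable good r≤ =
    𝓝 , r , part , isPartition , isEquitable ,
    (λ E ps → error-bound {ε} {e} 1<[1+e]ε 1≤e (arity L E) (symDiff-bound e good E ps)) ,
    indivisible , count-bound {ε} {e} eε≤1 (g +ℕ 2) r≤
    where
    open Lines 𝓜
    open Majority part

  -- `d` bounds the sum of the heights `pred τ` granted to all colours. Depth 0 is separate: there g
  -- = 0, and the hypothesis on ε yields only e ≥ 4.
  byDepth : ∀ d → nL L *ℕ pred τ ≡ d → ∃ λ kε → (N : ℕ) (𝓜 : Structure L N) → N ≥ kε → NonBranching τ 𝓜 → Conclusion 𝓜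
  -- The only part has to be inhabited, hence the threshold 1.
  byDepth zero d≡0 = 1 , onePart
    where
    onePart : (N : ℕ) (𝓜 : Structure L N) → N ≥ 1 → NonBranching τ 𝓜 → Conclusion 𝓜
    onePart (suc N) 𝓜 _ nb = conclude {r = 1} 𝓜 (λ _ → zero) (λ { zero → zero , refl }) (λ { zero zero → n≤1+n _ })
      (λ { zero → good }) (m^n>0 e {{>-nonZero 1≤e}} (g +ℕ 2))
      where
      open Lines 𝓜
      good : Good (4 *ℕ e) full
      -- A split is a tree of height 1. Its colour makes n_L positive, so d = 0 gives `pred τ` = 0,
      -- and trees of height 1 are excluded.
      good with good? (4 *ℕ e) full
      ... | inj₁ ok = ok
      ... | inj₂ split@(c , _) = ⊥-elim (unshattered-pred nb c
              (subst (λ h → Shatter c (suc h) full) (sym pred≡0) (Split⇒Shatter {4 *ℕ e} {full} split)))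
        where
        instance
          nL≢0 : NonZero (nL L)
          nL≢0 = >-nonZero (≤-trans (∈⇒0<length (∈colours L c)) (length-colours L))
        pred≡0 : pred τ ≡ 0
        pred≡0 = n≤0⇒n≡0 (≤-trans (m≤n*m (pred τ) (nL L)) (≤-reflexive d≡0))
  byDepth d@(suc _) eq = proj₁ bound , λ N 𝓜 N≥k nb →
    let u , u≢0 , Qu≤N , N≤ , few = proj₂ bound N N≥k
    in manyParts N 𝓜 nb u {{u≢0}} Qu≤N N≤ few
    where
    b = 4 *ℕ e *ℕ 4
    -- `Q *ℕ u` is the size 2b(4b)^d(2bu) that N must reach for cutting blocks of size bu.
    Q = 2 *ℕ b *ℕ ((4 *ℕ b) ^ℕ d *ℕ (2 *ℕ b))
    instance
      e≢0 : NonZero e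
      e≢0 = >-nonZero 1≤e
      b≢0 : NonZero b
      b≢0 = m*n≢0 (4 *ℕ e) 4 {{m*n≢0 4 e}}
    Q≢0 : NonZero Q
    Q≢0 = m*n≢0 (2 *ℕ b) _ {{m*n≢0 2 b}} {{m*n≢0 _ (2 *ℕ b) {{m^n≢0 (4 *ℕ b) d {{m*n≢0 4 b}}}} {{m*n≢0 2 b}}}}
    bound = threshold (nL L) (qL L) Q {{Q≢0}}
    2d≤g : 2 *ℕ d ≤ℕ g
    2d≤g = subst (λ n → 2 *ℕ n ≤ℕ g) eq (2d≤gOf L τ (subst NonZero (sym eq) _))
    2≤g : 2 ≤ℕ g
    2≤g = ≤-trans (*-monoʳ-≤ 2 {1} {d} (s≤s z≤n)) 2d≤g
    -- Positive depth gives g ≥ 2, so (g + 1)(g + 2) ≥ 12 ≥ 7, and 2^7 = 128.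
    128≤e : 128 ≤ℕ e
    128≤e = ≤-trans (^-monoʳ-≤ 2 {7} {suc g *ℕ suc (suc g)}
      (≤-trans (m≤m+n 7 5) (*-mono-≤ {3} {suc g} {4} {suc (suc g)} (s≤s 2≤g) (s≤s (s≤s 2≤g))))) 2^≤e
    manyParts : ∀ N 𝓜 → NonBranching τ 𝓜 → ∀ u .{{_ : NonZero u}} → Q *ℕ u ≤ℕ N → N ≤ℕ Q *ℕ (2 *ℕ u) →
      nL L *ℕ N ^ℕ qL L ≤ℕ 2 ^ℕ u → Conclusion 𝓜
    manyParts N 𝓜 nb u Qu≤N N≤ few =
      let r , part , isPartition , isEquitable , good , rm≤N =
            regular-partition e b u d (λ _ → pred τ) refl (≤-trans (length-tests≤ {{N≢0}}) few) ∑≤d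
              (λ (c , tree) → unshattered-pred nb c tree) (≤-trans (≤-reflexive (regroup b ((4 *ℕ b) ^ℕ d) u)) Qu≤N)
      in conclude 𝓜 part isPartition isEquitable good
           (≤-trans (part-count e b d {r} {u} {N} refl 128≤e rm≤N N≤) (^-monoʳ-≤ e 2[1+d]≤g+2))
      where
      open Lines 𝓜
      N≢0 : NonZero N
      N≢0 = >-nonZero (≤-trans (>-nonZero⁻¹ (Q *ℕ u) {{m*n≢0 Q u {{Q≢0}}}}) Qu≤N)
      regroup : ∀ b X u → 2 *ℕ b *ℕ (X *ℕ (2 *ℕ (b *ℕ u))) ≡ 2 *ℕ b *ℕ (X *ℕ (2 *ℕ b)) *ℕ u
      regroup = solve-∀
      ∑≤d : ∑ (colours L) (λ _ → pred τ) ≤ℕ d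
      ∑≤d = begin
        ∑ (colours L) (λ _ → pred τ)            ≡⟨ ∑-const (colours L) (pred τ) ⟩
        length (colours L) *ℕ pred τ            ≤⟨ *-monoˡ-≤ (pred τ) (length-colours L) ⟩
        nL L *ℕ pred τ                          ≡⟨ eq ⟩
        d                                       ∎
        where open ≤-Reasoning
      -- The 2 added to g pays for the factor 8b ≤ e² standing beside (4b)^d.
      2[1+d]≤g+2 : 2 *ℕ suc d ≤ℕ g +ℕ 2
      2[1+d]≤g+2 = ≤-trans (≤-reflexive (trans (*-suc 2 d) (+-comm 2 (2 *ℕ d)))) (+-monoˡ-≤ 2 2d≤g)
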